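{- Let $A\in\mathcal{L}_0$. The following are equivalent: (1) the substitution $\theta_A$ is $A$-projective and $\vdash \theta_A(A)\leftrightarrow A^\dagger$; (2) $A$ is ${\sf NNIL}({\sf par})$-projective, i.e. there are an $A$-projective substitution $\theta$ and $B\in{\sf NNIL}({\sf par})$ with $\vdash\theta(A)\leftrightarrow B$; (3) $A$ is ${\sf par}$-extendible.
   Context: Language and logic. $\mathcal{L}_0$ is the propositional language with connectives $\wedge,\vee,\to,\bot$ ($\neg A:=A\to\bot$, $\top:=\neg\bot$) over a finite set of atoms ${\sf atom}={\sf var}\cup{\sf par}$, where ${\sf var}$ (variables) and ${\sf par}$ (parameters) are disjoint finite sets. $\vdash$ is derivability in intuitionistic propositional logic ${\sf IPC}$. For $X\subseteq{\sf atom}$, $\mathcal{L}_0(X)$ is the set of formulas all of whose atoms lie in $X$. Substitutions. A substitution is a map $\theta$ on $\mathcal{L}_0$ commuting with $\wedge,\vee,\to$, with $\theta(\bot)=\bot$ and $\theta(p)=p$ for every $p\in{\sf par}$. $\theta$ is $A$-projective if $A\vdash a\leftrightarrow\theta(a)$ for every atom $a$. NNIL. The classes ${\sf NI}$ and ${\sf NNIL}$ are the least classes containing all atoms, $\bot$ and $\top$, closed under $\wedge,\vee$, such that moreover $B\to C\in{\sf NNIL}$ whenever $B\in{\sf NI}$ and $C\in{\sf NNIL}$ (${\sf NI}$ is not closed under $\to$). ${\sf NNIL}({\sf par}):={\sf NNIL}\cap\mathcal{L}_0({\sf par})$; up to ${\sf IPC}$-equivalence it is finite. Kripke models. A Kripke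 model is $\mathcal{K}=(W,\prec,V)$ with $W$ finite, $\prec$ a strict partial order whose reflexive closure $\preccurlyeq$ makes $W$ a rooted tree, and $V\subseteq W\times{\sf atom}$ persistent (upward closed); forcing $\Vdash$ is the usual intuitionistic one. $\mathcal{K}\Vdash A$ means $A$ is forced at the root. $\mathcal{K}\Vdash^- A$ means $A$ is forced at every node other than the root. For a set ${\bf p}$ of atoms, $\mathcal{K}\Vdash{\bf p}$ means the root forces every element of ${\bf p}$. For $\mathcal{K}$, let $\{\mathcal{K}\}_{\sf par}:=\{B\in{\sf NNIL}({\sf par}):\mathcal{K}\Vdash B\}$. Submodels and variants. For ${\bf a}\subseteq{\sf atom}$, $\mathcal{K}'=(W',\prec',V')\sqsubseteq^{i}_{\bf a}\mathcal{K}=(W,\prec,V)$ means $W'\subseteq W$, $\prec'$ is the restriction of $\prec$ to $W'$, and for $w\in W'$, $a\in{\bf a}$: $w V' a$ iff $w V a$. $\mathcal{K}''$ is an ${\bf a}$-variant of $\mathcal{K}'$ if they have the same frame and the same valuation except possibly at the root and only for atoms not in ${\bf a}$. $A$ is ${\sf par}$-extendible if for every Kripke model $\mathcal{K}\Vdash A$ and every Kripke model $\mathcal{K}'\sqsubseteq^i_{\sf par}\mathcal{K}$ with $\mathcal{K}'\Vdash^-A$, some ${\sf par}$-variant $\mathcal{K}''$ of $\mathcal{K}'$ satisfies $\mathcal{K}''\Vdash A$. The substitution $\theta_A$. For ${\bf x}\subseteq{\sf var}$ let $\theta^{\bf x}_A$ be the substitution with $\theta^{\bf x}_A(x)=A\to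 x$ for $x\in{\bf x}$ and $\theta^{\bf x}_A(x)=A\wedge x$ for $x\in{\sf var}\setminus{\bf x}$. Let ${\bf x}_1,\dots,{\bf x}_s$ list all subsets of ${\sf var}$ so that ${\bf x}_i\subseteq{\bf x}_j$ implies $i\le j$, and $\theta_A:=\theta^{{\bf x}_s}_A\circ\theta^{{\bf x}_{s-1}}_A\circ\cdots\circ\theta^{{\bf x}_1}_A$. The formula $A^\dagger$. $A^\dagger:=\bigwedge_{{\bf p}\subseteq{\sf par}}\big(\bigwedge{\bf p}\to\bigvee_{\mathcal{K}\Vdash{\bf p},\ \mathcal{K}\Vdash A}\bigwedge\{\mathcal{K}\}_{\sf par}\big)$, where the disjunction ranges over Kripke models forcing all of ${\bf p}$ and $A$ (finite up to ${\sf IPC}$-equivalence; empty disjunction is $\bot$). -}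

module Defs where

open import Data.Nat using (ℕ; zero; suc; _≤_)
open import Data.Fin using (Fin; toℕ)
open import Data.Bool using (Bool; true; false; T; if_then_else_)
open import Data.Vec using (Vec; []; _∷_)
open import Data.List using (List; []; _∷_; map; foldr; filter; allFin; length; lookup; _++_)
open import Data.List.Membership.Propositional using () renaming (_∈_ to _∈L_)
open import Data.List.Relation.Unary.Unique.Propositional using (Unique)
open import Data.Product using (Σ; _×_; _,_)
open import Data.Sum using (_⊎_)
open import Data.Empty using () renaming (⊥ to Empty)
open import Relation.Nullary using (¬_; does)
open import Relation.Binary.PropositionalEquality using (_≡_; _≢_)
import Data.Fin.Subset as S
open S using (Subset; _⊆_) renaming (_∈_ to _∈S_)
open import Data.Fin.Subset.Properties using (_∈?_)

data Atom (nv np : ℕ) : Set where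
  var : Fin nv → Atom nv np
  par : Fin np → Atom nv np

infixr 6 _∧_
infixr 5 _∨_
infixr 4 _⇒_

data Fm (nv np : ℕ) : Set where
  at  : Atom nv np → Fm nv np
  ⊥'  : Fm nv np
  _∧_ : Fm nv np → Fm nv np → Fm nv np
  _∨_ : Fm nv np → Fm nv np → Fm nv np
  _⇒_ : Fm nv np → Fm nv np → Fm nv np

module _ {nv np : ℕ} where

  ¬' : Fm nv np → Fm nv np
  ¬' A = A ⇒ ⊥'

  ⊤' : Fm nv np
  ⊤' = ¬' ⊥'

  _⇔'_ : Fm nv np → Fm nv np → Fm nv np
  A ⇔' B = (A ⇒ B) ∧ (B ⇒ A)

  ⋀ : List (Fm nv np) → Fm nv np
  ⋀ = foldr _∧_ ⊤'

  ⋁ : List (Fm nv np) → Fm nv np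
  ⋁ = foldr _∨_ ⊥'

  infix 2 _⊢_
  data _⊢_ (Γ : List (Fm nv np)) : Fm nv np → Set where
    hyp  : ∀ {A} → A ∈L Γ → Γ ⊢ A
    ⊥E   : ∀ {A} → Γ ⊢ ⊥' → Γ ⊢ A
    ∧I   : ∀ {A B} → Γ ⊢ A → Γ ⊢ B → Γ ⊢ A ∧ B
    ∧E₁  : ∀ {A B} → Γ ⊢ A ∧ B → Γ ⊢ A
    ∧E₂  : ∀ {A B} → Γ ⊢ A ∧ B → Γ ⊢ B
    ∨I₁  : ∀ {A B} → Γ ⊢ A → Γ ⊢ A ∨ B
    ∨I₂  : ∀ {A B} → Γ ⊢ B → Γ ⊢ A ∨ B
    ∨E   : ∀ {A B C} → Γ ⊢ A ∨ B → (A ∷ Γ) ⊢ C → (B ∷ Γ) ⊢ C → Γ ⊢ C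
    ⇒I   : ∀ {A B} → (A ∷ Γ) ⊢ B → Γ ⊢ A ⇒ B
    ⇒E   : ∀ {A B} → Γ ⊢ A ⇒ B → Γ ⊢ A → Γ ⊢ B

  Thm : Fm nv np → Set
  Thm A = [] ⊢ A

-- Substitutions: parameters and ⊥ are fixed, so a substitution is
-- determined by the images of the variables.

  Subst : Set
  Subst = Fin nv → Fm nv np

  applyAt : Subst → Atom nv np → Fm nv np
  applyAt θ (var x) = θ x
  applyAt θ (par p) = at (par p)

  apply : Subst → Fm nv np → Fm nv np
  apply θ (at a)  = applyAt θ a
  apply θ ⊥'      = ⊥'
  apply θ (A ∧ B) = apply θ A ∧ apply θ B
  apply θ (A ∨ B) = apply θ A ∨ apply θ B
  apply θ (A ⇒ B) = apply θ A ⇒ apply θ B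

  idSubst : Subst
  idSubst x = at (var x)

  _∘s_ : Subst → Subst → Subst
  (θ₂ ∘s θ₁) x = apply θ₂ (θ₁ x)

  Projective : Fm nv np → Subst → Set
  Projective A θ = ∀ (a : Atom nv np) → (A ∷ []) ⊢ (at a ⇔' applyAt θ a)

  thetaX : Fm nv np → Subset nv → Subst
  thetaX A xs x = if does (x ∈? xs) then (A ⇒ at (var x)) else (A ∧ at (var x))

  thetaList : Fm nv np → List (Subset nv) → Subst
  thetaList A []         = idSubst
  thetaList A (xs ∷ xss) = thetaList A xss ∘s thetaX A xs

ValidListing : (nv : ℕ) → List (Subset nv) → Set
ValidListing nv L =
  (∀ (xs : Subset nv) → xs ∈L L) ×
  Unique L ×
  (∀ (i j : Fin (length L)) → lookup L i ⊆ lookup L j → toℕ i ≤ toℕ j)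

module _ {nv np : ℕ} where

  data NI : Fm nv np → Set where
    at  : ∀ a → NI (at a)
    bot : NI ⊥'
    top : NI ⊤'
    and : ∀ {A B} → NI A → NI B → NI (A ∧ B)
    or  : ∀ {A B} → NI A → NI B → NI (A ∨ B)

  data NNIL : Fm nv np → Set where
    at  : ∀ a → NNIL (at a)
    bot : NNIL ⊥'
    top : NNIL ⊤'
    and : ∀ {A B} → NNIL A → NNIL B → NNIL (A ∧ B)
    or  : ∀ {A B} → NNIL A → NNIL B → NNIL (A ∨ B)
    imp : ∀ {A B} → NI A → NNIL B → NNIL (A ⇒ B)

  data OnlyPar : Fm nv np → Set where
    par : ∀ p → OnlyPar (at (par p))
    bot : OnlyPar ⊥'
    and : ∀ {A B} → OnlyPar A → OnlyPar B → OnlyPar (A ∧ B)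
    or  : ∀ {A B} → OnlyPar A → OnlyPar B → OnlyPar (A ∨ B)
    imp : ∀ {A B} → OnlyPar A → OnlyPar B → OnlyPar (A ⇒ B)

  NNILpar : Fm nv np → Set
  NNILpar A = NNIL A × OnlyPar A

record Model (nv np : ℕ) : Set where
  field
    size   : ℕ
    _≺_    : Fin size → Fin size → Bool
    irrefl : ∀ w → ¬ T (w ≺ w)
    trans  : ∀ u v w → T (u ≺ v) → T (v ≺ w) → T (u ≺ w)
    root   : Fin size
    rootLeast : ∀ w → w ≡ root ⊎ T (root ≺ w)
    tree   : ∀ u v w → T (u ≺ w) → T (v ≺ w) → u ≡ v ⊎ T (u ≺ v) ⊎ T (v ≺ u)
    V      : Fin size → Atom nv np → Bool
    persist : ∀ u w a → T (u ≺ w) → T (V u a) → T (V w a)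

  _≼_ : Fin size → Fin size → Set
  u ≼ w = u ≡ w ⊎ T (u ≺ w)

open Model public

module _ {nv np : ℕ} where

  forces : (K : Model nv np) → Fin (size K) → Fm nv np → Set
  forces K w (at a)  = T (V K w a)
  forces K w ⊥'      = Empty
  forces K w (A ∧ B) = forces K w A × forces K w B
  forces K w (A ∨ B) = forces K w A ⊎ forces K w B
  forces K w (A ⇒ B) = ∀ u → _≼_ K w u → forces K u A → forces K u B

  _⊩_ : Model nv np → Fm nv np → Set
  K ⊩ A = forces K (root K) A

  _⊩⁻_ : Model nv np → Fm nv np → Set
  K ⊩⁻ A = ∀ w → w ≢ root K → forces K w A

  _⊩ₚ_ : Model nv np → Subset np → Set
  K ⊩ₚ ps = ∀ i → i ∈S ps → T (V K (root K) (par i))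

  record SubmodelPar (K' K : Model nv np) : Set where
    field
      emb     : Fin (size K') → Fin (size K)
      inj     : ∀ u w → emb u ≡ emb w → u ≡ w
      order   : ∀ u w → _≺_ K' u w ≡ _≺_ K (emb u) (emb w)
      valPar  : ∀ w i → V K' w (par i) ≡ V K (emb w) (par i)

  withVal : (K : Model nv np) (V'' : Fin (size K) → Atom nv np → Bool) →
            (∀ u w a → T (_≺_ K u w) → T (V'' u a) → T (V'' w a)) → Model nv np
  withVal K V'' pers = record
    { size = size K ; _≺_ = _≺_ K ; irrefl = irrefl K ; trans = trans K
    ; root = root K ; rootLeast = rootLeast K ; tree = tree K
    ; V = V'' ; persist = pers }

  ParVariantVal : (K : Model nv np) → (Fin (size K) → Atom nv np → Bool) → Set
  ParVariantVal K V'' =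
    (∀ w a → w ≢ root K → V'' w a ≡ V K w a) ×
    (∀ i → V'' (root K) (par i) ≡ V K (root K) (par i))

  ParExtendible : Fm nv np → Set
  ParExtendible A =
    ∀ (K K' : Model nv np) → K ⊩ A → SubmodelPar K' K → K' ⊩⁻ A →
    Σ (Fin (size K') → Atom nv np → Bool) λ V'' →
    Σ (∀ u w a → T (_≺_ K' u w) → T (V'' u a) → T (V'' w a)) λ pers →
    ParVariantVal K' V'' × (withVal K' V'' pers ⊩ A)

  -- C is (a representative of) ⋀{K}_par : an NNIL(par) formula forced
  -- by K that entails every NNIL(par) formula forced by K
  IsTheoryConj : Model nv np → Fm nv np → Set
  IsTheoryConj K C =
    NNILpar C × K ⊩ C × (∀ B → NNILpar B → K ⊩ B → (C ∷ []) ⊢ B)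

allSubsets : (n : ℕ) → List (Subset n)
allSubsets zero    = [] ∷ []
allSubsets (suc n) = map (true ∷_) (allSubsets n) ++ map (false ∷_) (allSubsets n)

module _ {nv np : ℕ} where

  conjPar : Subset np → Fm nv np
  conjPar ps = ⋀ (map (λ i → at (par i)) (filter (_∈? ps) (allFin np)))

  -- Ls p lists the disjuncts ⋀{K}_par for K ⊩ p, K ⊩ A (up to ⊢-equivalence)
  DaggerLists : Fm nv np → (Subset np → List (Fm nv np)) → Set
  DaggerLists A Ls = ∀ (ps : Subset np) →
    (∀ C → C ∈L Ls ps → Σ (Model nv np) λ K → K ⊩ₚ ps × K ⊩ A × IsTheoryConj K C) ×
    (∀ (K : Model nv np) → K ⊩ₚ ps → K ⊩ A →
       Σ (Fm nv np) λ C → C ∈L Ls ps × IsTheoryConj K C)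

  daggerOf : (Subset np → List (Fm nv np)) → Fm nv np
  daggerOf Ls = ⋀ (map (λ ps → conjPar ps ⇒ ⋁ (Ls ps)) (allSubsets np))

  Cond1 : List (Subset nv) → Fm nv np → Set
  Cond1 L A =
    Projective A (thetaList A L) ×
    Σ (Subset np → List (Fm nv np)) λ Ls →
      DaggerLists A Ls × Thm (apply (thetaList A L) A ⇔' daggerOf Ls)

  Cond2 : Fm nv np → Set
  Cond2 A = Σ Subst λ θ → Projective A θ ×
            Σ (Fm nv np) λ B → NNILpar B × Thm (apply θ A ⇔' B)

  Cond3 : Fm nv np → Set
  Cond3 = ParExtendible

{-# OPTIONS --safe #-}
module Submission where

-- (3) ⇒ (1) is Ghilardi's argument.  By completeness it suffices that every
-- finite tree t forcing A† forces θ_A(A), by induction on t.  At its root t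
-- forces the NNIL(par) theory of some model M of A, so t maps monotonically
-- and parameter-preservingly into M: were there no such map, this would be
-- expressed by a NNIL(par) formula true in M and false in t.  Enlarging M along
-- the map, t becomes a submodel of a model of A, and extendibility supplies a
-- set xs of variables whose truth at the root makes A true there once θ_A has
-- been applied above.  The step θ^xs of θ_A produces exactly this valuation.
--
-- (2) ⇒ (3) holds because NNIL formulas pass to submodels, the variant being
-- given by forcing of θ.  The disjunctions of A† are finite since up to mutual
-- simulation there are finitely many trees over the parameters.

open import Defs
open import Data.Nat using (ℕ)
open import Data.List using (List)
open import Data.Product using (_×_)
open import Data.Fin.Subset using (Subset)

import Data.Nat as ℕ
import Data.Nat.Properties as ℕₚ
open import Data.Bool using (Bool; true; false; T)
open import Data.Bool.Properties using (T?; T-≡; T-∧)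
open import Data.Fin using (Fin; toℕ)
import Data.Fin as F
import Data.List.Relation.Unary.Any as Any
open import Data.List.Relation.Unary.Any.Properties using (lookup-index)
open import Data.List.Properties using (++-identityʳ)
import Data.Fin.Properties as Fₚ
open import Data.Fin.Induction using (spo-noetherian)
open import Data.Fin.Subset using (_⊆_; ∣_∣) renaming (_∈_ to _∈S_)
open import Data.Fin.Subset.Properties using (_∈?_; ⊆-antisym; p⊂q⇒∣p∣<∣q∣; ∣p∣≤n)
open import Data.Vec as Vec using (tabulate)
open import Data.Vec.Properties using ([]=⇒lookup; lookup⇒[]=; lookup∘tabulate; tabulate-cong)
open import Data.List using ([]; _∷_; _++_; map; filter; length; lookup; allFin; cartesianProductWith)
open import Data.List.Membership.Propositional using () renaming (_∈_ to _∈L_)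
open import Data.List.Membership.Propositional.Properties
  using (∈-map⁺; ∈-map⁻; ∈-++⁺ˡ; ∈-++⁺ʳ; ∈-++⁻; ∈-filter⁺; ∈-filter⁻; ∈-allFin; ∈-cartesianProductWith⁺)
open import Data.List.Relation.Unary.Any using (here; there; any?)
open import Data.List.Relation.Unary.All as All using (All; []; _∷_)
open import Data.Product using (Σ; _,_; proj₁; proj₂)
open import Data.Product.Function.NonDependent.Propositional using (_×-⇔_)
open import Data.Sum using (_⊎_; inj₁; inj₂; [_,_]′)
open import Data.Sum.Function.Propositional using (_⊎-⇔_; _⊎-↔_)
open import Data.Sum.Properties using (inj₁-injective; inj₂-injective)
open import Data.Empty using (⊥-elim) renaming (⊥ to Empty)
open import Data.Unit using (⊤; tt)
open import Function using (_∘_; id; case_of_; _⇔_; mk⇔; Equivalence; _↔_; Inverse)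
open import Function.Construct.Composition using (_⇔-∘_; _↔-∘_)
open import Function.Construct.Symmetry using (⇔-sym)
open import Function.Construct.Identity using (⇔-id)
open import Induction.WellFounded using (Acc; acc)
open import Relation.Nullary using (¬_; Dec; yes; no; does; ¬?)
open import Relation.Nullary.Decidable using (_×-dec_; _⊎-dec_; _→-dec_; map′; dec-true; dec-false; decidable-stable)
open import Relation.Binary.Structures using (IsStrictPartialOrder)
open import Relation.Binary.PropositionalEquality using (_≡_; _≢_; refl; sym; cong; cong₂; subst; subst₂; isEquivalence; resp₂)
  renaming (trans to ≡-trans)
open Equivalence using (to; from)

-- The set `xs` is read off a variant of the valuation that θ_A as a whole produces, yet θ^xs is a
-- single step in the middle of the composition. The order of the listing bridges this gap. On a
-- tree the composition acts from the tail of the list, so after θ^xs only steps for sets not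
-- containing `xs` remain. By persistence all of `xs` is finally true above the root, and such later
-- steps could not achieve this together with A unless A was true there as soon as θ^xs had acted.
-- Since A → x and A ∧ x are both equivalent to x under A, a node that has gained A keeps its
-- valuation from then on, so the valuation seen by θ^xs above the root is already the final one.
-- Everything is constructive: forcing is decidable, completeness takes the form of a decision
-- between a derivation and a finite countermodel, and finiteness of NNIL(par) comes from an
-- explicit enumeration of trees.

private variable
  nv np : ℕ
  A B C : Fm nv np
  Γ Δ : List (Fm nv np)

-- Kripke semantics with decidable forcing.

record Kripke (nv np : ℕ) : Set₁ where
  field
    World   : Set
    _≤_     : World → World → Set
    ≤-refl  : ∀ {w} → w ≤ w
    ≤-trans : ∀ {u v w} → u ≤ v → v ≤ w → u ≤ w
    val     : World → Atom nv np → Bool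
    mono    : ∀ {u w} a → u ≤ w → T (val u a) → T (val w a)
    -- The substitute for excluded middle: it decides universal statements over the worlds above
    -- `w`, which is what forcing of an implication asks for. It is available for finite models and
    -- also for the infinite collection of all finite trees, where only finitely many trees lie
    -- above each one.
    search  : ∀ {P : World → Set} → (∀ u → Dec (P u)) → ∀ w →
              (∀ u → w ≤ u → P u) ⊎ (Σ World λ u → w ≤ u × ¬ P u)

open Kripke using (World; search)

module _ (𝓚 : Kripke nv np) where
  open Kripke 𝓚 hiding (World; search)

  infix 3 [_]_⊨_
  [_]_⊨_ : World 𝓚 → Fm nv np → Set
  [_]_⊨_ w (at a)  = T (val w a)
  [_]_⊨_ w ⊥'      = Empty
  [_]_⊨_ w (A ∧ B) = [_]_⊨_ w A × [_]_⊨_ w B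
  [_]_⊨_ w (A ∨ B) = [_]_⊨_ w A ⊎ [_]_⊨_ w B
  [_]_⊨_ w (A ⇒ B) = ∀ u → w ≤ u → [_]_⊨_ u A → [_]_⊨_ u B

module _ (𝓚 : Kripke nv np) where
  open Kripke 𝓚 hiding (World; search)

  ⊨-mono : ∀ A {w u} → w ≤ u → [ 𝓚 ] w ⊨ A → [ 𝓚 ] u ⊨ A
  ⊨-mono (at a)  le f        = mono a le f
  ⊨-mono (A ∧ B) le (f , g)  = ⊨-mono A le f , ⊨-mono B le g
  ⊨-mono (A ∨ B) le (inj₁ f) = inj₁ (⊨-mono A le f)
  ⊨-mono (A ∨ B) le (inj₂ f) = inj₂ (⊨-mono B le f)
  ⊨-mono (A ⇒ B) le f        = λ v le′ → f v (≤-trans le le′)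

  ⊨? : ∀ A w → Dec ([ 𝓚 ] w ⊨ A)
  ⊨? (at a)  w = T? (val w a)
  ⊨? ⊥'      w = no id
  ⊨? (A ∧ B) w = ⊨? A w ×-dec ⊨? B w
  ⊨? (A ∨ B) w = ⊨? A w ⊎-dec ⊨? B w
  ⊨? (A ⇒ B) w with search 𝓚 (λ u → ⊨? A u →-dec ⊨? B u) w
  ... | inj₁ f            = yes f
  ... | inj₂ (u , le , n) = no λ f → n (f u le)

  soundness : Γ ⊢ A → ∀ w → (∀ {B} → B ∈L Γ → [ 𝓚 ] w ⊨ B) → [ 𝓚 ] w ⊨ A
  soundness (hyp i)    w ρ = ρ i
  soundness (⊥E d)     w ρ = ⊥-elim (soundness d w ρ)
  soundness (∧I d e)   w ρ = soundness d w ρ , soundness e w ρ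
  soundness (∧E₁ d)    w ρ = proj₁ (soundness d w ρ)
  soundness (∧E₂ d)    w ρ = proj₂ (soundness d w ρ)
  soundness (∨I₁ d)    w ρ = inj₁ (soundness d w ρ)
  soundness (∨I₂ d)    w ρ = inj₂ (soundness d w ρ)
  soundness (∨E d e f) w ρ with soundness d w ρ
  ... | inj₁ x = soundness e w λ { (here refl) → x ; (there i) → ρ i }
  ... | inj₂ x = soundness f w λ { (here refl) → x ; (there i) → ρ i }
  soundness (⇒I d)     w ρ = λ u le x → soundness d u
    λ { (here refl) → x ; {B} (there i) → ⊨-mono B le (ρ i) }
  soundness (⇒E d e)   w ρ = soundness d w ρ w ≤-refl (soundness e w ρ)

  soundness₁ : (A ∷ []) ⊢ B → ∀ w → [ 𝓚 ] w ⊨ A → [ 𝓚 ] w ⊨ B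
  soundness₁ d w x = soundness d w λ { (here refl) → x }

  ⊨-⇔' : ∀ {A B w} → [ 𝓚 ] w ⊨ (A ⇔' B) → ([ 𝓚 ] w ⊨ A) ⇔ ([ 𝓚 ] w ⊨ B)
  ⊨-⇔' (f , g) = mk⇔ (f _ ≤-refl) (g _ ≤-refl)

  ⊨-⋀ : ∀ {w} As → ([ 𝓚 ] w ⊨ ⋀ As) ⇔ (∀ {B} → B ∈L As → [ 𝓚 ] w ⊨ B)
  ⊨-⋀ []       = mk⇔ (λ _ ()) (λ _ _ _ → id)
  ⊨-⋀ (A ∷ As) = mk⇔
    (λ { (x , xs) (here refl) → x ; (x , xs) (there i) → to (⊨-⋀ As) xs i })
    (λ f → f (here refl) , from (⊨-⋀ As) (λ i → f (there i)))

  ⊨-⋁ : ∀ {w} As → ([ 𝓚 ] w ⊨ ⋁ As) ⇔ (Σ _ λ B → B ∈L As × [ 𝓚 ] w ⊨ B)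
  ⊨-⋁ []       = mk⇔ (λ ()) (λ ())
  ⊨-⋁ (A ∷ As) = mk⇔
    (λ { (inj₁ x) → A , here refl , x
       ; (inj₂ x) → let B , i , y = to (⊨-⋁ As) x in B , there i , y })
    (λ { (_ , here refl , x) → inj₁ x
       ; (B , there i , x) → inj₂ (from (⊨-⋁ As) (B , i , x)) })

  ⊨-conjPar : ∀ {w} ps → ([ 𝓚 ] w ⊨ conjPar ps) ⇔ (∀ i → i ∈S ps → T (val w (par i)))
  ⊨-conjPar ps = mk⇔
    (λ f i i∈ → to (⊨-⋀ ats) f (∈-map⁺ (λ i → at (par i)) (∈-filter⁺ (_∈? ps) (∈-allFin i) i∈)))
    (λ f → from (⊨-⋀ ats) (λ i → atom f (∈-map⁻ (λ i → at (par i)) i)))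
    where
    is  = filter (_∈? ps) (allFin np)
    ats = map (λ i → at (par i)) is
    atom : ∀ {w B} → (∀ i → i ∈S ps → T (val w (par i))) →
           (Σ (Fin np) λ i → i ∈L is × B ≡ at (par i)) → [ 𝓚 ] w ⊨ B
    atom f (i , i∈ , refl) = f i (proj₂ (∈-filter⁻ (_∈? ps) {xs = allFin np} i∈))

-- Substitutions, bisimulations and simulations.

apply-id : (A : Fm nv np) → apply idSubst A ≡ A
apply-id (at (var x)) = refl
apply-id (at (par p)) = refl
apply-id ⊥'      = refl
apply-id (A ∧ B) = cong₂ _∧_ (apply-id A) (apply-id B)
apply-id (A ∨ B) = cong₂ _∨_ (apply-id A) (apply-id B)
apply-id (A ⇒ B) = cong₂ _⇒_ (apply-id A) (apply-id B)

apply-OnlyPar : (σ : Subst {nv} {np}) → OnlyPar A → apply σ A ≡ A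
apply-OnlyPar σ (par p)   = refl
apply-OnlyPar σ bot       = refl
apply-OnlyPar σ (and x y) = cong₂ _∧_ (apply-OnlyPar σ x) (apply-OnlyPar σ y)
apply-OnlyPar σ (or x y)  = cong₂ _∨_ (apply-OnlyPar σ x) (apply-OnlyPar σ y)
apply-OnlyPar σ (imp x y) = cong₂ _⇒_ (apply-OnlyPar σ x) (apply-OnlyPar σ y)

-- A bisimulation along which the σ-image of each atom on the left matches
-- the τ-image on the right.
module Bisimulation (𝓚 𝓛 : Kripke nv np) (σ τ : Subst {nv} {np})
  (_~_ : World 𝓚 → World 𝓛 → Set)
  (forth : ∀ {w v w′} → w ~ v → Kripke._≤_ 𝓚 w w′ → Σ (World 𝓛) λ v′ → Kripke._≤_ 𝓛 v v′ × w′ ~ v′)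
  (back  : ∀ {w v v′} → w ~ v → Kripke._≤_ 𝓛 v v′ → Σ (World 𝓚) λ w′ → Kripke._≤_ 𝓚 w w′ × w′ ~ v′)
  (atoms : ∀ {w v} → w ~ v → ∀ a → ([ 𝓚 ] w ⊨ applyAt σ a) ⇔ ([ 𝓛 ] v ⊨ applyAt τ a))
  where

  ⊨⇔ : ∀ A {w v} → w ~ v → ([ 𝓚 ] w ⊨ apply σ A) ⇔ ([ 𝓛 ] v ⊨ apply τ A)
  ⊨⇔ (at a)  z = atoms z a
  ⊨⇔ ⊥'      z = ⇔-id _
  ⊨⇔ (A ∧ B) z = ⊨⇔ A z ×-⇔ ⊨⇔ B z
  ⊨⇔ (A ∨ B) z = ⊨⇔ A z ⊎-⇔ ⊨⇔ B z
  ⊨⇔ (A ⇒ B) z = mk⇔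
    (λ f v′ le x → let w′ , le′ , z′ = back z le in
       to (⊨⇔ B z′) (f w′ le′ (from (⊨⇔ A z′) x)))
    (λ f w′ le x → let v′ , le′ , z′ = forth z le in
       from (⊨⇔ B z′) (f v′ le′ (to (⊨⇔ A z′) x)))

module Simulation (𝓚 𝓛 : Kripke nv np)
  (_~_ : World 𝓚 → World 𝓛 → Set)
  (forth : ∀ {w v w′} → w ~ v → Kripke._≤_ 𝓚 w w′ → Σ (World 𝓛) λ v′ → Kripke._≤_ 𝓛 v v′ × w′ ~ v′)
  (atoms : ∀ {w v} → w ~ v → ∀ i → Kripke.val 𝓚 w (par i) ≡ Kripke.val 𝓛 v (par i))
  where

  NI⇔ : ∀ {A w v} → NI A → OnlyPar A → w ~ v → ([ 𝓚 ] w ⊨ A) ⇔ ([ 𝓛 ] v ⊨ A)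
  NI⇔ (at _)    (par p)   z = mk⇔ (subst T (atoms z p)) (subst T (sym (atoms z p)))
  NI⇔ bot       _         z = ⇔-id _
  NI⇔ top       _         z = mk⇔ (λ _ _ _ → id) (λ _ _ _ → id)
  NI⇔ (and x y) (and p q) z = NI⇔ x p z ×-⇔ NI⇔ y q z
  NI⇔ (or x y)  (or p q)  z = NI⇔ x p z ⊎-⇔ NI⇔ y q z

  -- An NI antecedent has no implication except ⊤, so its truth depends on the parameters of one
  -- world and transfers both ways. The implication case then needs only `forth`.
  reflect : ∀ {A w v} → NNIL A → OnlyPar A → w ~ v → [ 𝓛 ] v ⊨ A → [ 𝓚 ] w ⊨ A
  reflect (at _)    (par p)   z f        = subst T (sym (atoms z p)) f
  reflect top       _         z f        = λ _ _ → id
  reflect (and x y) (and p q) z (f , g)  = reflect x p z f , reflect y q z g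
  reflect (or x y)  (or p q)  z (inj₁ f) = inj₁ (reflect x p z f)
  reflect (or x y)  (or p q)  z (inj₂ f) = inj₂ (reflect y q z f)
  reflect (imp x y) (imp p q) z f        = λ w′ le a → let v′ , le′ , z′ = forth z le in
    reflect y q z′ (f v′ le′ (to (NI⇔ x p z′) a))

-- Worlds forcing `C` form an upward closed set, so the identity restricted to them is a
-- bisimulation.
⊨-agree : (𝓚 : Kripke nv np) (C : Fm nv np) (σ τ : Subst {nv} {np}) →
          (∀ {w} → [ 𝓚 ] w ⊨ C → ∀ x → ([ 𝓚 ] w ⊨ σ x) ⇔ ([ 𝓚 ] w ⊨ τ x)) →
          ∀ B {w} → [ 𝓚 ] w ⊨ C → ([ 𝓚 ] w ⊨ apply σ B) ⇔ ([ 𝓚 ] w ⊨ apply τ B)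
⊨-agree 𝓚 C σ τ agree B x =
  Bisimulation.⊨⇔ 𝓚 𝓚 σ τ (λ u v → u ≡ v × [ 𝓚 ] u ⊨ C)
    (λ { (refl , y) le → _ , le , refl , ⊨-mono 𝓚 C le y })
    (λ { (refl , y) le → _ , le , refl , ⊨-mono 𝓚 C le y })
    (λ { (refl , y) (var a) → agree y a ; (refl , y) (par a) → ⇔-id _ })
    B (refl , x)

⊨-projective : ∀ {σ : Subst {nv} {np}} → Projective A σ → (𝓚 : Kripke nv np) →
               ∀ B {w} → [ 𝓚 ] w ⊨ A → ([ 𝓚 ] w ⊨ B) ⇔ ([ 𝓚 ] w ⊨ apply σ B)
⊨-projective {A = A} {σ = σ} proj 𝓚 B {w} x =
  subst (λ X → ([ 𝓚 ] w ⊨ X) ⇔ ([ 𝓚 ] w ⊨ apply σ B)) (apply-id B)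
    (⊨-agree 𝓚 A idSubst σ (λ y a → ⊨-⇔' 𝓚 {A = at (var a)} {B = σ a} (soundness₁ 𝓚 (proj (var a)) _ y)) B x)

-- Finite trees as Kripke models

data Tree (nv np : ℕ) : Set where
  node : (Atom nv np → Bool) → List (Tree nv np) → Tree nv np

children : Tree nv np → List (Tree nv np)
children (node _ cs) = cs

tree-ind : (P : Tree nv np → Set) → (∀ t → (∀ {c} → c ∈L children t → P c) → P t) → ∀ t → P t
tree-inds : (P : Tree nv np → Set) → (∀ t → (∀ {c} → c ∈L children t → P c) → P t) →
            ∀ cs {c} → c ∈L cs → P c
tree-ind P h (node l cs) = h (node l cs) (tree-inds P h cs)
tree-inds P h (c ∷ cs) (here refl) = tree-ind P h c
tree-inds P h (c ∷ cs) (there i)   = tree-inds P h cs i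

infix 4 _⊑_
data _⊑_ {nv np} (t : Tree nv np) : Tree nv np → Set where
  done : t ⊑ t
  step : ∀ {c s} → c ∈L children t → c ⊑ s → t ⊑ s

⊑-trans : ∀ {t s r : Tree nv np} → t ⊑ s → s ⊑ r → t ⊑ r
⊑-trans done       q = q
⊑-trans (step i p) q = step i (⊑-trans p q)

-- An atom holds at t when it is in the label of every node of t, so that
-- persistence needs no side condition on labels.
treeVal  : Tree nv np → Atom nv np → Bool
treeVals : List (Tree nv np) → Atom nv np → Bool
treeVal (node l cs) a = l a Data.Bool.∧ treeVals cs a
treeVals []       a = true
treeVals (c ∷ cs) a = treeVal c a Data.Bool.∧ treeVals cs a

treeVals⇔ : ∀ (cs : List (Tree nv np)) a → T (treeVals cs a) ⇔ (∀ {c} → c ∈L cs → T (treeVal c a))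
treeVals⇔ []       a = mk⇔ (λ _ ()) _
treeVals⇔ (c ∷ cs) a = mk⇔
  (λ f → λ { (here refl) → proj₁ (to T-∧ f) ; (there i) → to (treeVals⇔ cs a) (proj₂ (to T-∧ f)) i })
  (λ f → from T-∧ (f (here refl) , from (treeVals⇔ cs a) (λ i → f (there i))))

T-⇔⇒≡ : ∀ {x y} → T x ⇔ T y → x ≡ y
T-⇔⇒≡ {false} {false} e = refl
T-⇔⇒≡ {false} {true}  e = ⊥-elim (from e tt)
T-⇔⇒≡ {true}  {false} e = ⊥-elim (to e tt)
T-⇔⇒≡ {true}  {true}  e = refl

treeVal-node : ∀ {l : Atom nv np → Bool} {cs} a → (∀ {c} → c ∈L cs → T (l a) → T (treeVal c a)) →
               treeVal (node l cs) a ≡ l a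
treeVal-node {cs = cs} a h = T-⇔⇒≡ (mk⇔ (proj₁ ∘ to T-∧)
  (λ x → from T-∧ (x , from (treeVals⇔ cs a) (λ i → h i x))))

treeVal-mono : ∀ {t s : Tree nv np} a → t ⊑ s → T (treeVal t a) → T (treeVal s a)
treeVal-mono a done f = f
treeVal-mono {t = node l cs} a (step i p) f = treeVal-mono a p (to (treeVals⇔ cs a) (proj₂ (to T-∧ f)) i)

T-does : ∀ {P : Set} (d : Dec P) → T (does d) ⇔ P
T-does (yes p) = mk⇔ (λ _ → p) _
T-does (no n)  = mk⇔ (λ ()) n

all⊎any : ∀ {X Z : Set} {P : X → Set} xs → (∀ {x} → x ∈L xs → P x ⊎ Z) → (∀ {x} → x ∈L xs → P x) ⊎ Z
all⊎any []       f = inj₁ λ ()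
all⊎any (x ∷ xs) f with f (here refl) | all⊎any xs (λ i → f (there i))
... | inj₂ z | _      = inj₂ z
... | inj₁ p | inj₂ z = inj₂ z
... | inj₁ p | inj₁ q = inj₁ λ { (here refl) → p ; (there i) → q i }

treeSearch : ∀ {P : Tree nv np → Set} → (∀ u → Dec (P u)) → ∀ t →
             (∀ u → t ⊑ u → P u) ⊎ (Σ (Tree nv np) λ u → t ⊑ u × ¬ P u)
treeSearch {P = P} P? = tree-ind _ λ t ih → case P? t of λ where
  (no n)  → inj₂ (t , done , n)
  (yes p) → case all⊎any (children t)
                  (λ {c} i → case ih i of λ where
                     (inj₁ f)            → inj₁ f
                     (inj₂ (u , le , n)) → inj₂ (u , step i le , n)) of λ where
    (inj₁ f) → inj₁ λ { u done → p ; u (step i q) → f i u q }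
    (inj₂ z) → inj₂ z

𝕋 : (nv np : ℕ) → Kripke nv np
𝕋 nv np = record
  { World = Tree nv np ; _≤_ = _⊑_ ; ≤-refl = done ; ≤-trans = ⊑-trans
  ; val = treeVal ; mono = treeVal-mono ; search = treeSearch }

infix 3 _⊨_
_⊨_ : Tree nv np → Fm nv np → Set
t ⊨ A = [ 𝕋 _ _ ] t ⊨ A

⊨-⇒ : ∀ {A B : Fm nv np} {t} → (t ⊨ A ⇒ B) ⇔ ((t ⊨ A → t ⊨ B) × (∀ {c} → c ∈L children t → c ⊨ A ⇒ B))
⊨-⇒ = mk⇔ (λ f → f _ done , λ {c} i u le → f u (step i le))
           (λ { (f , g) u done → f ; (f , g) u (step i le) → g i u le })

-- Completeness

weaken : (∀ {B} → B ∈L Γ → B ∈L Δ) → Γ ⊢ A → Δ ⊢ A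
weaken ρ (hyp i)    = hyp (ρ i)
weaken ρ (⊥E d)     = ⊥E (weaken ρ d)
weaken ρ (∧I d e)   = ∧I (weaken ρ d) (weaken ρ e)
weaken ρ (∧E₁ d)    = ∧E₁ (weaken ρ d)
weaken ρ (∧E₂ d)    = ∧E₂ (weaken ρ d)
weaken ρ (∨I₁ d)    = ∨I₁ (weaken ρ d)
weaken ρ (∨I₂ d)    = ∨I₂ (weaken ρ d)
weaken ρ (∨E d e f) = ∨E (weaken ρ d) (weaken (lift ρ) e) (weaken (lift ρ) f)
  where
  lift : ∀ {C Γ Δ} → (∀ {B : Fm _ _} → B ∈L Γ → B ∈L Δ) → ∀ {B} → B ∈L (C ∷ Γ) → B ∈L (C ∷ Δ)
  lift ρ (here e)  = here e
  lift ρ (there i) = there (ρ i)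
weaken ρ (⇒I d)     = ⇒I (weaken (λ { (here e) → here e ; (there i) → there (ρ i) }) d)
weaken ρ (⇒E d e)   = ⇒E (weaken ρ d) (weaken ρ e)

cut : Γ ⊢ A → (A ∷ Γ) ⊢ C → Γ ⊢ C
cut d e = ⇒E (⇒I e) d

-- Removal by position, which avoids deciding equality of formulas; further copies of `x` may
-- survive in `ys`. The length equation is the termination measure of `decide` and `adjoin`.
extract : ∀ {X : Set} {xs : List X} {x} → x ∈L xs →
          Σ (List X) λ ys → length xs ≡ ℕ.suc (length ys) ×
          (∀ {y} → y ∈L xs → y ≡ x ⊎ y ∈L ys) × (∀ {y} → y ∈L ys → y ∈L xs)
extract {xs = x ∷ xs} (here refl) = xs , refl , (λ { (here e) → inj₁ e ; (there i) → inj₂ i }) , there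
extract {xs = x ∷ xs} (there i) with extract i
... | ys , e , f , g = x ∷ ys , cong ℕ.suc e ,
  (λ { (here e) → inj₂ (here e) ; (there j) → [ inj₁ , inj₂ ∘ there ]′ (f j) }) ,
  (λ { (here e) → here e ; (there j) → there (g j) })

gather : ∀ {X Y : Set} {N : X → Set} {Q : Y → Set} {R : X → Y → Set} xs →
         (∀ {x} → x ∈L xs → N x ⊎ Σ Y (λ y → Q y × R x y)) →
         Σ (List Y) λ ys → (∀ {y} → y ∈L ys → Q y) × (∀ {x} → x ∈L xs → N x ⊎ Σ Y λ y → y ∈L ys × R x y)
gather []       f = [] , (λ ()) , λ ()
gather (x ∷ xs) f with f (here refl) | gather xs (λ i → f (there i))
... | inj₁ n           | ys , q , r = ys , q , λ { (here refl) → inj₁ n ; (there i) → r i }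
... | inj₂ (y , p , s) | ys , q , r = y ∷ ys , (λ { (here refl) → p ; (there i) → q i }) , λ where
  (here refl) → inj₂ (y , here refl , s)
  (there i)   → [ inj₁ , (λ { (z , j , s) → inj₂ (z , there j , s) }) ]′ (r i)

_≟at_ : (a : Atom nv np) (B : Fm nv np) → Dec (at a ≡ B)
var x ≟at at (var y) = map′ (cong (λ z → Fm.at (Atom.var z))) (λ { refl → refl }) (x F.≟ y)
par x ≟at at (par y) = map′ (cong (λ z → Fm.at (Atom.par z))) (λ { refl → refl }) (x F.≟ y)
var x ≟at at (par y) = no λ ()
par x ≟at at (var y) = no λ ()
a ≟at ⊥'      = no λ ()
a ≟at (_ ∧ _) = no λ ()
a ≟at (_ ∨ _) = no λ ()
a ≟at (_ ⇒ _) = no λ ()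

Countermodel : List (Fm nv np) → Fm nv np → Set
Countermodel Γ C = Σ (Tree _ _) λ t → (∀ {B} → B ∈L Γ → t ⊨ B) × ¬ (t ⊨ C)

SubformulaClosed : List (Fm nv np) → Set
SubformulaClosed S =
  (∀ {A B} → A ∧ B ∈L S → A ∈L S × B ∈L S) ×
  (∀ {A B} → A ∨ B ∈L S → A ∈L S × B ∈L S) ×
  (∀ {A B} → (A ⇒ B) ∈L S → A ∈L S × B ∈L S)

-- Γ grows within the subformula-closed list S, and U lists the formulas of S
-- still undecided.  Either some undecided D can be added without proving C, or
-- every D ∷ Γ proves C; then Γ behaves like a prime theory as long as it does
-- not prove C itself, and serves as the root of a countermodel.
module Completeness (S : List (Fm nv np)) (closed : SubformulaClosed S) where

  module Step (U Γ : List (Fm nv np)) (C : Fm nv np)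
    (Γ⊆S : ∀ {B} → B ∈L Γ → B ∈L S)
    (split : ∀ {B} → B ∈L S → B ∈L Γ ⊎ B ∈L U)
    (ih : ∀ {D G} → D ∈L U → G ∈L S → (D ∷ Γ) ⊢ G ⊎ Countermodel (D ∷ Γ) G)
    (maximal : ∀ {D} → D ∈L U → (D ∷ Γ) ⊢ C)
    where

    status : ∀ {B} → B ∈L S → Γ ⊢ B ⊎ (B ∷ Γ) ⊢ C
    status i = [ inj₁ ∘ hyp , inj₂ ∘ maximal ]′ (split i)

    -- If `Γ` proves the antecedent, truth of the implication is settled at the root; if `Γ` proves
    -- the implication, no tree forcing `Γ` refutes it. Every other implication gets a child that
    -- refutes it.
    NotNeeded : Fm nv np → Set
    NotNeeded (A ⇒ B) = Γ ⊢ A ⊎ Γ ⊢ A ⇒ B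
    NotNeeded _       = ⊤

    Refutes : Fm nv np → Tree nv np → Set
    Refutes (A ⇒ B) t = t ⊨ A × ¬ (t ⊨ B)
    Refutes _       t = Empty

    refuter : ∀ {B} → B ∈L S → NotNeeded B ⊎ Σ (Tree nv np) λ t → (∀ {D} → D ∈L Γ → t ⊨ D) × Refutes B t
    refuter {at _}  i = inj₁ tt
    refuter {⊥'}    i = inj₁ tt
    refuter {A ∧ B} i = inj₁ tt
    refuter {A ∨ B} i = inj₁ tt
    refuter {A ⇒ B} i with proj₂ (proj₂ closed) i
    ... | iA , iB with split iA
    ... | inj₁ j = inj₁ (inj₁ (hyp j))
    ... | inj₂ j with ih j iB
    ... | inj₁ d           = inj₁ (inj₂ (⇒I d))
    ... | inj₂ (t , ρ , n) = inj₂ (t , (λ k → ρ (there k)) , ρ (here refl) , n)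

    refuters = gather {N = NotNeeded} {R = Refutes} S refuter

    cs : List (Tree nv np)
    cs = proj₁ refuters

    cs⊨Γ : ∀ {c} → c ∈L cs → ∀ {D} → D ∈L Γ → c ⊨ D
    cs⊨Γ = proj₁ (proj₂ refuters)

    inΓ? : ∀ a → Dec (at a ∈L Γ)
    inΓ? a = any? (a ≟at_) Γ

    t : Tree nv np
    t = node (λ a → does (inΓ? a)) cs

    val-t : ∀ a → treeVal t a ≡ does (inΓ? a)
    val-t a = treeVal-node {l = λ a → does (inΓ? a)} a λ i x → cs⊨Γ i (to (T-does (inΓ? a)) x)

    -- `(B ∷ Γ) ⊢ C` is a positive form of unprovability: a proof of `B` would yield one of `C` by
    -- cut, which is the other outcome of `truth`.
    Truth : Fm nv np → Set
    Truth B = ((Γ ⊢ B) × t ⊨ B) ⊎ (((B ∷ Γ) ⊢ C) × ¬ (t ⊨ B))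

    negative : ∀ {B} → B ∈L S → (Γ ⊢ B → Γ ⊢ C) → ¬ (t ⊨ B) → Γ ⊢ C ⊎ Truth B
    negative i f n = [ inj₁ ∘ f , (λ d → inj₂ (inj₂ (d , n))) ]′ (status i)

    truth : ∀ B → B ∈L S → Γ ⊢ C ⊎ Truth B
    truth (at a) i with inΓ? a | val-t a
    ... | yes j | e = inj₂ (inj₁ (hyp j , subst T (sym e) tt))
    ... | no n  | e = case split i of λ where
      (inj₁ j) → ⊥-elim (n j)
      (inj₂ j) → inj₂ (inj₂ (maximal j , λ x → subst T e x))
    truth ⊥' i = negative i ⊥E id
    truth (A ∧ B) i with proj₁ closed i
    ... | iA , iB with truth A iA | truth B iB
    ... | inj₁ z | _ = inj₁ z
    ... | inj₂ _ | inj₁ z = inj₁ z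
    ... | inj₂ (inj₁ (d , x)) | inj₂ (inj₁ (e , y)) = inj₂ (inj₁ (∧I d e , x , y))
    ... | inj₂ (inj₂ (d , n)) | inj₂ _ = negative i (λ e → cut (∧E₁ e) d) (n ∘ proj₁)
    ... | inj₂ (inj₁ _) | inj₂ (inj₂ (d , n)) = negative i (λ e → cut (∧E₂ e) d) (n ∘ proj₂)
    truth (A ∨ B) i with proj₁ (proj₂ closed) i
    ... | iA , iB with truth A iA | truth B iB
    ... | inj₁ z | _ = inj₁ z
    ... | inj₂ _ | inj₁ z = inj₁ z
    ... | inj₂ (inj₁ (d , x)) | inj₂ _ = inj₂ (inj₁ (∨I₁ d , inj₁ x))
    ... | inj₂ (inj₂ _) | inj₂ (inj₁ (d , x)) = inj₂ (inj₁ (∨I₂ d , inj₂ x))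
    ... | inj₂ (inj₂ (d , n)) | inj₂ (inj₂ (e , m)) = negative i (λ f → ∨E f d e) [ n , m ]′
    truth (A ⇒ B) i with proj₂ (proj₂ closed) i
    ... | iA , iB with truth A iA | truth B iB
    ... | inj₁ z | _ = inj₁ z
    ... | inj₂ _ | inj₁ z = inj₁ z
    ... | inj₂ _ | inj₂ (inj₁ (d , x)) =
      inj₂ (inj₁ (⇒I (weaken there d) , λ u le _ → ⊨-mono (𝕋 _ _) B le x))
    ... | inj₂ (inj₁ (d , x)) | inj₂ (inj₂ (e , m)) = negative i (λ f → cut (⇒E f d) e) (λ f → m (f t done x))
    ... | inj₂ (inj₂ (d , n)) | inj₂ (inj₂ (e , m)) with proj₂ (proj₂ refuters) i
    ... | inj₂ (c , j , x , y) =
      negative i (λ f → ⊥-elim (y (soundness (𝕋 _ _) f c (cs⊨Γ j) c done x))) (λ f → y (f c (step j done) x))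
    ... | inj₁ (inj₁ d′) = inj₁ (cut d′ d)
    ... | inj₁ (inj₂ f)  = inj₂ (inj₁ (f , from (⊨-⇒ {A = A} {B})
      ((λ x → ⊥-elim (n x)) , λ j → soundness (𝕋 _ _) f _ (cs⊨Γ j))))

    result : C ∈L S → Γ ⊢ C ⊎ Countermodel Γ C
    result i with truth C i | all⊎any Γ positive
      where
      positive : ∀ {B} → B ∈L Γ → t ⊨ B ⊎ Γ ⊢ C
      positive j with truth _ (Γ⊆S j)
      ... | inj₁ z              = inj₂ z
      ... | inj₂ (inj₁ (_ , x)) = inj₁ x
      ... | inj₂ (inj₂ (d , _)) = inj₂ (cut (hyp j) d)
    ... | inj₁ z              | _      = inj₁ z
    ... | inj₂ (inj₁ (d , _)) | _      = inj₁ d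
    ... | inj₂ (inj₂ _)       | inj₂ z = inj₁ z
    ... | inj₂ (inj₂ (_ , n)) | inj₁ p = inj₂ (t , p , n)

  decide : ∀ n U Γ {C} → length U ≡ n → (∀ {B} → B ∈L Γ → B ∈L S) → (∀ {B} → B ∈L U → B ∈L S) →
           (∀ {B} → B ∈L S → B ∈L Γ ⊎ B ∈L U) → C ∈L S → Γ ⊢ C ⊎ Countermodel Γ C
  adjoin : ∀ n U Γ {D G} → length U ≡ n → (∀ {B} → B ∈L Γ → B ∈L S) → (∀ {B} → B ∈L U → B ∈L S) →
           (∀ {B} → B ∈L S → B ∈L Γ ⊎ B ∈L U) → D ∈L U → G ∈L S → (D ∷ Γ) ⊢ G ⊎ Countermodel (D ∷ Γ) G

  decide n U Γ {C} len Γ⊆S U⊆S split i with all⊎any U attempt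
    where
    attempt : ∀ {D} → D ∈L U → (D ∷ Γ) ⊢ C ⊎ Countermodel Γ C
    attempt j with adjoin n U Γ len Γ⊆S U⊆S split j i
    ... | inj₁ d           = inj₁ d
    ... | inj₂ (t , ρ , n) = inj₂ (t , (λ k → ρ (there k)) , n)
  ... | inj₂ m       = inj₂ m
  ... | inj₁ maximal = Step.result U Γ C Γ⊆S split (adjoin n U Γ len Γ⊆S U⊆S split) maximal i

  adjoin n U Γ {D} len Γ⊆S U⊆S split j i with extract j
  adjoin ℕ.zero    U Γ len Γ⊆S U⊆S split j i | U′ , e , _ , _ = case ≡-trans (sym e) len of λ ()
  adjoin (ℕ.suc n) U Γ len Γ⊆S U⊆S split j i | U′ , e , keeps , drops =
    decide n _ _ (ℕₚ.suc-injective (≡-trans (sym e) len))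
      (λ { (here refl) → U⊆S j ; (there k) → Γ⊆S k })
      (λ k → U⊆S (drops k))
      (λ k → [ inj₁ ∘ there , (λ l → [ inj₁ ∘ here , inj₂ ]′ (keeps l)) ]′ (split k))
      i

parts : Fm nv np → List (Fm nv np)
parts (at a)  = at a ∷ []
parts ⊥'      = ⊥' ∷ []
parts (A ∧ B) = (A ∧ B) ∷ parts A ++ parts B
parts (A ∨ B) = (A ∨ B) ∷ parts A ++ parts B
parts (A ⇒ B) = (A ⇒ B) ∷ parts A ++ parts B

∈-parts : (A : Fm nv np) → A ∈L parts A
∈-parts (at a)  = here refl
∈-parts ⊥'      = here refl
∈-parts (A ∧ B) = here refl
∈-parts (A ∨ B) = here refl
∈-parts (A ⇒ B) = here refl

parts-trans : ∀ A {B C : Fm nv np} → B ∈L parts A → C ∈L parts B → C ∈L parts A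
parts-trans₂ : ∀ A₁ A₂ {B C : Fm nv np} → B ∈L parts A₁ ++ parts A₂ → C ∈L parts B → C ∈L parts A₁ ++ parts A₂
parts-trans (at a)  (here refl) j = j
parts-trans ⊥'      (here refl) j = j
parts-trans (A ∧ B) (here refl) j = j
parts-trans (A ∧ B) (there i)   j = there (parts-trans₂ A B i j)
parts-trans (A ∨ B) (here refl) j = j
parts-trans (A ∨ B) (there i)   j = there (parts-trans₂ A B i j)
parts-trans (A ⇒ B) (here refl) j = j
parts-trans (A ⇒ B) (there i)   j = there (parts-trans₂ A B i j)
parts-trans₂ A₁ A₂ i j with ∈-++⁻ (parts A₁) i
... | inj₁ k = ∈-++⁺ˡ (parts-trans A₁ k j)
... | inj₂ k = ∈-++⁺ʳ (parts A₁) (parts-trans A₂ k j)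

parts-closed : (A : Fm nv np) → SubformulaClosed (parts A)
parts-closed A =
  (λ i → both i there) , (λ i → both i there) , (λ i → both i there)
  where
  both : ∀ {B C D} → D ∈L parts A → (∀ {E} → E ∈L parts B ++ parts C → E ∈L parts D) →
         B ∈L parts A × C ∈L parts A
  both {B} {C} i sub =
    parts-trans A i (sub (∈-++⁺ˡ (∈-parts B))) , parts-trans A i (sub (∈-++⁺ʳ (parts B) (∈-parts C)))

parts-⋀ : ∀ {As} {A : Fm nv np} → A ∈L As → A ∈L parts (⋀ As)
parts-⋀ {As = A ∷ As} (here refl) = there (∈-++⁺ˡ (∈-parts A))
parts-⋀ {As = A ∷ As} (there i)   = there (∈-++⁺ʳ (parts A) (parts-⋀ i))

-- Stated as a disjunction so that it also decides derivability, by which the disjuncts of A† are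
-- later selected.
derivable⊎countermodel : ∀ Γ (C : Fm nv np) → Γ ⊢ C ⊎ Countermodel Γ C
derivable⊎countermodel Γ C =
  -- At the start every formula of `S` counts as undecided, including those already in `Γ`.
  Completeness.decide S (parts-closed F) (length S) S Γ refl
    (λ i → parts-⋀ {As = C ∷ Γ} (there i)) id inj₂ (parts-⋀ {As = C ∷ Γ} (here refl))
  where
  F = ⋀ (C ∷ Γ)
  S = parts F

completeness : (∀ t → (∀ {B} → B ∈L Γ → t ⊨ B) → t ⊨ C) → Γ ⊢ C
completeness {Γ = Γ} {C} h with derivable⊎countermodel Γ C
... | inj₁ d           = d
... | inj₂ (t , ρ , n) = ⊥-elim (n (h t ρ))

completeness-⇔' : ∀ {A B : Fm nv np} → (∀ t → (∀ {B} → B ∈L Γ → t ⊨ B) → (t ⊨ A) ⇔ (t ⊨ B)) → Γ ⊢ A ⇔' B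
completeness-⇔' {A = A} {B} h = completeness λ t ρ →
  (λ u le → to (h u (λ {D} i → ⊨-mono (𝕋 _ _) D le (ρ i)))) ,
  (λ u le → from (h u (λ {D} i → ⊨-mono (𝕋 _ _) D le (ρ i))))

_⊢?_ : ∀ Γ (C : Fm nv np) → Dec (Γ ⊢ C)
Γ ⊢? C with derivable⊎countermodel Γ C
... | inj₁ d           = yes d
... | inj₂ (t , ρ , n) = no λ d → n (soundness (𝕋 _ _) d t ρ)

-- Models and trees

⟦_⟧ : Model nv np → Kripke nv np
⟦ K ⟧ = record
  { World = Fin (size K) ; _≤_ = _≼_ K ; ≤-refl = inj₁ refl ; ≤-trans = ≼-trans
  ; val = V K ; mono = mono ; search = λ {P} P? w → search′ P P? w }
  where
  ≼-trans : ∀ {u v w} → _≼_ K u v → _≼_ K v w → _≼_ K u w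
  ≼-trans (inj₁ refl) q           = q
  ≼-trans (inj₂ p)    (inj₁ refl) = inj₂ p
  ≼-trans (inj₂ p)    (inj₂ q)    = inj₂ (Model.trans K _ _ _ p q)
  mono : ∀ {u w} a → _≼_ K u w → T (V K u a) → T (V K w a)
  mono a (inj₁ refl) = id
  mono a (inj₂ p)    = persist K _ _ a p
  ≼? : ∀ u w → Dec (_≼_ K u w)
  ≼? u w = (u F.≟ w) ⊎-dec T? (_≺_ K u w)
  search′ : (P : Fin (size K) → Set) → (∀ u → Dec (P u)) → ∀ w →
            (∀ u → _≼_ K w u → P u) ⊎ (Σ (Fin (size K)) λ u → _≼_ K w u × ¬ P u)
  search′ P P? w with Fₚ.any? (λ u → ≼? w u ×-dec ¬? (P? u))
  ... | yes x = inj₂ x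
  ... | no n  = inj₁ λ u le → decidable-stable (P? u) λ m → n (u , le , m)

forces⇔⊨ : (K : Model nv np) → ∀ A {w} → forces K w A ⇔ ([ ⟦ K ⟧ ] w ⊨ A)
forces⇔⊨ K (at a)  = ⇔-id _
forces⇔⊨ K ⊥'      = ⇔-id _
forces⇔⊨ K (A ∧ B) = forces⇔⊨ K A ×-⇔ forces⇔⊨ K B
forces⇔⊨ K (A ∨ B) = forces⇔⊨ K A ⊎-⇔ forces⇔⊨ K B
forces⇔⊨ K (A ⇒ B) = mk⇔
  (λ f u le x → to (forces⇔⊨ K B) (f u le (from (forces⇔⊨ K A) x)))
  (λ f u le x → from (forces⇔⊨ K B) (f u le (to (forces⇔⊨ K A) x)))

-- Unravelling by Noetherian recursion. All strict successors become children, not just the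
-- immediate ones; the shape of `K` changes but forcing does not.
tree-of : (K : Model nv np) → ∀ w → Σ (Tree nv np) λ t → ∀ A → ([ ⟦ K ⟧ ] w ⊨ A) ⇔ (t ⊨ A)
tree-of {nv} {np} K w = go w (spo-noetherian isSPO w)
  where
  isSPO : IsStrictPartialOrder _≡_ (λ u v → T (_≺_ K u v))
  isSPO = record
    { isEquivalence = isEquivalence
    ; irrefl = λ { refl → irrefl K _ }
    ; trans = λ p q → Model.trans K _ _ _ p q
    ; <-resp-≈ = resp₂ (λ u v → T (_≺_ K u v)) }
  _≈_ : Fin (size K) → Tree nv np → Set
  w ≈ t = ∀ A → ([ ⟦ K ⟧ ] w ⊨ A) ⇔ (t ⊨ A)
  go : ∀ w → Acc (λ u v → T (_≺_ K v u)) w → Σ (Tree nv np) (w ≈_)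
  go w (acc rs) = t , w≈t
    where
    unravelled = gather {N = λ u → ¬ T (_≺_ K w u)}
                        {Q = λ t → Σ _ λ u → T (_≺_ K w u) × u ≈ t} {R = _≈_} (allFin (size K))
      λ {u} _ → case T? (_≺_ K w u) of λ where
        (no n)  → inj₁ n
        (yes p) → let t , e = go u (rs p) in inj₂ (t , (u , p , e) , e)
    t = node (V K w) (proj₁ unravelled)
    w≈t : w ≈ t
    w≈t (at a)  = mk⇔ (subst T (sym e)) (subst T e)
      where
      e : treeVal t a ≡ V K w a
      e = treeVal-node {l = V K w} a λ i x → let u , p , f = proj₁ (proj₂ unravelled) i in
            to (f (at a)) (persist K _ _ a p x)
    w≈t ⊥'      = ⇔-id _
    w≈t (A ∧ B) = w≈t A ×-⇔ w≈t B
    w≈t (A ∨ B) = w≈t A ⊎-⇔ w≈t B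
    w≈t (A ⇒ B) = mk⇔
      (λ f → from (⊨-⇒ {A = A} {B}) ( (λ x → to (w≈t B) (f w (inj₁ refl) (from (w≈t A) x)))
                      , λ i → let u , p , e = proj₁ (proj₂ unravelled) i in
                              to (e (A ⇒ B)) (⊨-mono ⟦ K ⟧ (A ⇒ B) (inj₂ p) f)))
      (λ f → λ { u (inj₁ refl) x → from (w≈t B) (proj₁ (to (⊨-⇒ {A = A} {B}) f) (to (w≈t A) x))
               ; u (inj₂ p)    x → case proj₂ (proj₂ unravelled) (∈-allFin u) of λ where
                   (inj₁ n)           → ⊥-elim (n p)
                   (inj₂ (c , i , e)) → from (e (A ⇒ B)) (proj₂ (to (⊨-⇒ {A = A} {B}) f) i) u (inj₁ refl) x })

-- The nodes of a tree, addressed from the root; the left summand is the root itself.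
Path  : Tree nv np → Set
Paths : List (Tree nv np) → Set
Path (node l cs) = ⊤ ⊎ Paths cs
Paths []       = Empty
Paths (c ∷ cs) = Path c ⊎ Paths cs

count  : Tree nv np → ℕ
counts : List (Tree nv np) → ℕ
count (node l cs) = ℕ.suc (counts cs)
counts []       = 0
counts (c ∷ cs) = count c ℕ.+ counts cs

path↔  : (t : Tree nv np) → Fin (count t) ↔ Path t
paths↔ : (cs : List (Tree nv np)) → Fin (counts cs) ↔ Paths cs
path↔ (node l cs) = (Fₚ.1↔⊤ ⊎-↔ paths↔ cs) ↔-∘ Fₚ.+↔⊎
paths↔ []       = Fₚ.0↔⊥
paths↔ (c ∷ cs) = (path↔ c ⊎-↔ paths↔ cs) ↔-∘ Fₚ.+↔⊎

apex : (t : Tree nv np) → Path t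
apex (node l cs) = inj₁ tt

below  : (t : Tree nv np) → Path t → Path t → Bool
belows : (cs : List (Tree nv np)) → Paths cs → Paths cs → Bool
below (node l cs) p        (inj₁ _) = false
below (node l cs) (inj₁ _) (inj₂ q) = true
below (node l cs) (inj₂ p) (inj₂ q) = belows cs p q
belows (c ∷ cs) (inj₁ p) (inj₁ q) = below c p q
belows (c ∷ cs) (inj₂ p) (inj₂ q) = belows cs p q
belows (c ∷ cs) _        _        = false

below-irrefl  : ∀ (t : Tree nv np) p → ¬ T (below t p p)
belows-irrefl : ∀ (cs : List (Tree nv np)) p → ¬ T (belows cs p p)
below-irrefl (node l cs) (inj₂ p) = belows-irrefl cs p
belows-irrefl (c ∷ cs) (inj₁ p) = below-irrefl c p
belows-irrefl (c ∷ cs) (inj₂ p) = belows-irrefl cs p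

below-trans  : ∀ (t : Tree nv np) p q r → T (below t p q) → T (below t q r) → T (below t p r)
belows-trans : ∀ (cs : List (Tree nv np)) p q r → T (belows cs p q) → T (belows cs q r) → T (belows cs p r)
below-trans (node l cs) (inj₁ _) (inj₂ q) (inj₂ r) f g = tt
below-trans (node l cs) (inj₂ p) (inj₂ q) (inj₂ r) f g = belows-trans cs p q r f g
belows-trans (c ∷ cs) (inj₁ p) (inj₁ q) (inj₁ r) f g = below-trans c p q r f g
belows-trans (c ∷ cs) (inj₂ p) (inj₂ q) (inj₂ r) f g = belows-trans cs p q r f g

below-tree  : ∀ (t : Tree nv np) p q r → T (below t p r) → T (below t q r) →
              p ≡ q ⊎ T (below t p q) ⊎ T (below t q p)
belows-tree : ∀ (cs : List (Tree nv np)) p q r → T (belows cs p r) → T (belows cs q r) →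
              p ≡ q ⊎ T (belows cs p q) ⊎ T (belows cs q p)
below-tree (node l cs) (inj₁ _) (inj₁ _) r        f g = inj₁ refl
below-tree (node l cs) (inj₁ _) (inj₂ q) r        f g = inj₂ (inj₁ tt)
below-tree (node l cs) (inj₂ p) (inj₁ _) r        f g = inj₂ (inj₂ tt)
below-tree (node l cs) (inj₂ p) (inj₂ q) (inj₂ r) f g = [ inj₁ ∘ cong inj₂ , inj₂ ]′ (belows-tree cs p q r f g)
belows-tree (c ∷ cs) (inj₁ p) (inj₁ q) (inj₁ r) f g = [ inj₁ ∘ cong inj₁ , inj₂ ]′ (below-tree c p q r f g)
belows-tree (c ∷ cs) (inj₂ p) (inj₂ q) (inj₂ r) f g = [ inj₁ ∘ cong inj₂ , inj₂ ]′ (belows-tree cs p q r f g)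

apex-least : ∀ (t : Tree nv np) p → p ≡ apex t ⊎ T (below t (apex t) p)
apex-least (node l cs) (inj₁ _) = inj₁ refl
apex-least (node l cs) (inj₂ p) = inj₂ tt

subtree  : (t : Tree nv np) → Path t → Tree nv np
subtrees : (cs : List (Tree nv np)) → Paths cs → Tree nv np
subtree (node l cs) (inj₁ _) = node l cs
subtree (node l cs) (inj₂ p) = subtrees cs p
subtrees (c ∷ cs) (inj₁ p) = subtree c p
subtrees (c ∷ cs) (inj₂ p) = subtrees cs p

subtree-apex : (t : Tree nv np) → subtree t (apex t) ≡ t
subtree-apex (node l cs) = refl

subtrees-⊑ : ∀ (cs : List (Tree nv np)) p → Σ _ λ c → c ∈L cs × c ⊑ subtrees cs p
subtree-⊑  : ∀ (t : Tree nv np) p → t ⊑ subtree t p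
subtree-⊑ (node l cs) (inj₁ _) = done
subtree-⊑ (node l cs) (inj₂ p) = let c , i , le = subtrees-⊑ cs p in step i le
subtrees-⊑ (c ∷ cs) (inj₁ p) = c , here refl , subtree-⊑ c p
subtrees-⊑ (c ∷ cs) (inj₂ p) = let d , i , le = subtrees-⊑ cs p in d , there i , le

subtree-below : ∀ (t : Tree nv np) p → T (below t (apex t) p) → Σ _ λ c → c ∈L children t × c ⊑ subtree t p
subtree-below (node l cs) (inj₂ p) _ = subtrees-⊑ cs p

below-⊑  : ∀ (t : Tree nv np) p q → T (below t p q) → subtree t p ⊑ subtree t q
belows-⊑ : ∀ (cs : List (Tree nv np)) p q → T (belows cs p q) → subtrees cs p ⊑ subtrees cs q
below-⊑ (node l cs) (inj₁ _) (inj₂ q) f = subtree-⊑ (node l cs) (inj₂ q)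
below-⊑ (node l cs) (inj₂ p) (inj₂ q) f = belows-⊑ cs p q f
belows-⊑ (c ∷ cs) (inj₁ p) (inj₁ q) f = below-⊑ c p q f
belows-⊑ (c ∷ cs) (inj₂ p) (inj₂ q) f = belows-⊑ cs p q f

path-to  : ∀ {t s : Tree nv np} → t ⊑ s → Σ (Path t) λ q → subtree t q ≡ s
paths-to : ∀ {cs : List (Tree nv np)} {c s} → c ∈L cs → c ⊑ s → Σ (Paths cs) λ q → subtrees cs q ≡ s
path-to {t = t} done = apex t , subtree-apex t
path-to {t = node l cs} (step i le) = let q , e = paths-to i le in inj₂ q , e
paths-to (here refl) le = let q , e = path-to le in inj₁ q , e
paths-to (there i)   le = let q , e = paths-to i le in inj₂ q , e

child-path : ∀ {t c : Tree nv np} → c ∈L children t → Σ (Path t) λ p → T (below t (apex t) p) × subtree t p ≡ c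
child-path {t = node l cs} i = let q , e = paths-to i done in inj₂ q , tt , e

⊑-below  : ∀ (t : Tree nv np) p {s} → subtree t p ⊑ s →
           Σ (Path t) λ q → (p ≡ q ⊎ T (below t p q)) × subtree t q ≡ s
⊑-belows : ∀ (cs : List (Tree nv np)) p {s} → subtrees cs p ⊑ s →
           Σ (Paths cs) λ q → (p ≡ q ⊎ T (belows cs p q)) × subtrees cs q ≡ s
⊑-below (node l cs) (inj₁ tt) le with path-to le
... | inj₁ tt , e = inj₁ tt , inj₁ refl , e
... | inj₂ q  , e = inj₂ q , inj₂ tt , e
⊑-below (node l cs) (inj₂ p) le with ⊑-belows cs p le
... | q , inj₁ refl , e = inj₂ q , inj₁ refl , e
... | q , inj₂ f    , e = inj₂ q , inj₂ f , e
⊑-belows (c ∷ cs) (inj₁ p) le with ⊑-below c p le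
... | q , inj₁ refl , e = inj₁ q , inj₁ refl , e
... | q , inj₂ f    , e = inj₁ q , inj₂ f , e
⊑-belows (c ∷ cs) (inj₂ p) le with ⊑-belows cs p le
... | q , inj₁ refl , e = inj₂ q , inj₁ refl , e
... | q , inj₂ f    , e = inj₂ q , inj₂ f , e

-- The valuation stays a parameter, so that the valuation given by a substitution and the variant
-- supplied by extendibility can live on the same frame.
module PathModel (t : Tree nv np) where

  path : Fin (count t) → Path t
  path = Inverse.to (path↔ t)

  index : Path t → Fin (count t)
  index = Inverse.from (path↔ t)

  path-index : ∀ p → path (index p) ≡ p
  path-index p = Inverse.inverseˡ (path↔ t) refl

  path-injective : ∀ {u w} → path u ≡ path w → u ≡ w
  path-injective {u} {w} e =
    ≡-trans (sym (Inverse.inverseʳ (path↔ t) refl)) (≡-trans (cong index e) (Inverse.inverseʳ (path↔ t) refl))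

  _<_ : Fin (count t) → Fin (count t) → Bool
  u < w = below t (path u) (path w)

  module _ (v : Fin (count t) → Atom nv np → Bool)
           (pers : ∀ u w a → T (u < w) → T (v u a) → T (v w a)) where

    model : Model nv np
    model = record
      { size = count t ; _≺_ = _<_
      ; irrefl = λ w → below-irrefl t (path w)
      ; trans = λ u v w → below-trans t (path u) (path v) (path w)
      ; root = index (apex t)
      ; rootLeast = least
      ; tree = tree′
      ; V = v ; persist = pers }
      where
      least : ∀ w → w ≡ index (apex t) ⊎ T (index (apex t) < w)
      least w with apex-least t (path w)
      ... | inj₁ e = inj₁ (path-injective (≡-trans e (sym (path-index (apex t)))))
      ... | inj₂ f = inj₂ (subst (λ p → T (below t p (path w))) (sym (path-index (apex t))) f)
      tree′ : ∀ u v w → T (u < w) → T (v < w) → u ≡ v ⊎ T (u < v) ⊎ T (v < u)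
      tree′ u v w f g with below-tree t (path u) (path v) (path w) f g
      ... | inj₁ e = inj₁ (path-injective e)
      ... | inj₂ h = inj₂ h

    module _ (σ : Subst {nv} {np})
             (atoms : ∀ w a → T (v w a) ⇔ (subtree t (path w) ⊨ applyAt σ a)) where

      private
        forth : ∀ {w s w′} → subtree t (path w) ≡ s → _≼_ model w w′ →
                Σ (Tree nv np) λ s′ → s ⊑ s′ × subtree t (path w′) ≡ s′
        forth refl (inj₁ refl) = _ , done , refl
        forth refl (inj₂ f)    = _ , below-⊑ t _ _ f , refl
        back : ∀ {w s s′} → subtree t (path w) ≡ s → s ⊑ s′ →
               Σ (Fin (count t)) λ w′ → _≼_ model w w′ × subtree t (path w′) ≡ s′
        back {w} refl le with ⊑-below t (path w) le
        ... | q , inj₁ e , e′ = w , inj₁ refl , ≡-trans (cong (subtree t) e) e′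
        ... | q , inj₂ f , e′ = index q
          , inj₂ (subst (λ p → T (below t (path w) p)) (sym (path-index q)) f)
          , ≡-trans (cong (subtree t) (path-index q)) e′
        atoms′ : ∀ {w s} → subtree t (path w) ≡ s → ∀ a →
                 ([ ⟦ model ⟧ ] w ⊨ applyAt idSubst a) ⇔ (s ⊨ applyAt σ a)
        atoms′ {w} refl (var x) = atoms w (var x)
        atoms′ {w} refl (par i) = atoms w (par i)

      forces⇔ : ∀ A w → forces model w A ⇔ (subtree t (path w) ⊨ apply σ A)
      forces⇔ A w =
        subst (λ B → ([ ⟦ model ⟧ ] w ⊨ B) ⇔ (subtree t (path w) ⊨ apply σ A)) (apply-id A)
          (Bisimulation.⊨⇔ ⟦ model ⟧ (𝕋 nv np) idSubst σ (λ w s → subtree t (path w) ≡ s) forth back atoms′ A refl)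
          ⇔-∘ forces⇔⊨ model A

      ⊩⇔ : ∀ A → (model ⊩ A) ⇔ (t ⊨ apply σ A)
      ⊩⇔ A = subst (λ s → (model ⊩ A) ⇔ (s ⊨ apply σ A))
        (≡-trans (cong (subtree t) (path-index (apex t))) (subtree-apex t)) (forces⇔ A _)

module SubstModel {nv np : ℕ} (σ : Subst {nv} {np}) (t : Tree nv np) where
  open PathModel t public using (path; index; path-index; path-injective; _<_)

  value? : ∀ w a → Dec (subtree t (path w) ⊨ applyAt σ a)
  value? w a = ⊨? (𝕋 nv np) (applyAt σ a) (subtree t (path w))

  value : Fin (count t) → Atom nv np → Bool
  value w a = does (value? w a)

  value-mono : ∀ u w a → T (u < w) → T (value u a) → T (value w a)
  value-mono u w a lt x = from (T-does (value? w a))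
    (⊨-mono (𝕋 nv np) (applyAt σ a) (below-⊑ t _ _ lt) (to (T-does (value? u a)) x))

substModel : Subst {nv} {np} → Tree nv np → Model nv np
substModel σ t = PathModel.model t (SubstModel.value σ t) (SubstModel.value-mono σ t)

substModel-forces : ∀ (σ : Subst {nv} {np}) t A w →
                    forces (substModel σ t) w A ⇔ (subtree t (PathModel.path t w) ⊨ apply σ A)
substModel-forces σ t = PathModel.forces⇔ t _ _ σ (λ w a → T-does (SubstModel.value? σ t w a))

substModel-⊩ : ∀ (σ : Subst {nv} {np}) t A → (substModel σ t ⊩ A) ⇔ (t ⊨ apply σ A)
substModel-⊩ σ t = PathModel.⊩⇔ t _ _ σ (λ w a → T-does (SubstModel.value? σ t w a))

nonroot : ∀ (t : Tree nv np) {w} → w ≢ PathModel.index t (apex t) →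
          Σ (Tree nv np) λ c → c ∈L children t × c ⊑ subtree t (PathModel.path t w)
nonroot t {w} n with apex-least t (PathModel.path t w)
... | inj₁ e = ⊥-elim (n (PathModel.path-injective t (≡-trans e (sym (PathModel.path-index t (apex t))))))
... | inj₂ f = subtree-below t _ f

treeModel : Tree nv np → Model nv np
treeModel = substModel idSubst

treeModel-⊩ : ∀ (t : Tree nv np) A → (treeModel t ⊩ A) ⇔ (t ⊨ A)
treeModel-⊩ t A = subst (λ B → (treeModel t ⊩ A) ⇔ (t ⊨ B)) (apply-id A) (substModel-⊩ idSubst t A)

-- Simulations and the NNIL(par) theory of a tree

pars : Tree nv np → Subset np
pars t = tabulate λ i → treeVal t (par i)

∈-tabulate : ∀ {n} (f : Fin n → Bool) i → i ∈S tabulate f ⇔ T (f i)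
∈-tabulate f i = mk⇔
  (λ x → from T-≡ (≡-trans (sym (lookup∘tabulate f i)) ([]=⇒lookup x)))
  (λ x → lookup⇒[]= i _ (≡-trans (lookup∘tabulate f i) (to T-≡ x)))

pars-≡ : ∀ {s t : Tree nv np} → pars s ≡ pars t → ∀ i → treeVal s (par i) ≡ treeVal t (par i)
pars-≡ {s = s} {t} e i =
  ≡-trans (sym (lookup∘tabulate _ i)) (≡-trans (cong (λ ps → Vec.lookup ps i) e) (lookup∘tabulate _ i))

pars-⊆ : ∀ {s t : Tree nv np} → s ⊑ t → pars s ⊆ pars t
pars-⊆ le {i} x = from (∈-tabulate _ i) (treeVal-mono (par i) le (to (∈-tabulate _ i) x))

-- Match s t: some monotone, parameter-preserving map from the nodes of s to
-- those of t sends root to root.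
data Match {nv np} (s t : Tree nv np) : Set where
  match : pars s ≡ pars t →
          All (λ c → Σ (Tree nv np) λ t′ → t ⊑ t′ × Match c t′) (children s) → Match s t

Sim : Tree nv np → Tree nv np → Set
Sim s t = Σ (Tree _ _) λ t′ → t ⊑ t′ × Match s t′

Match-pars : ∀ {s t : Tree nv np} → Match s t → pars s ≡ pars t
Match-pars (match e _) = e

Match-forth : ∀ {s t s′ : Tree nv np} → Match s t → s ⊑ s′ → Sim s′ t
Match-forth m done = _ , done , m
Match-forth (match _ ms) (step i le) =
  let t₁ , le₁ , m  = All.lookup ms i
      t₂ , le₂ , m′ = Match-forth m le
  in t₂ , ⊑-trans le₁ le₂ , m′

Sim-⊑ : ∀ {s t t′ : Tree nv np} → t ⊑ t′ → Sim s t′ → Sim s t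
Sim-⊑ le (u , le′ , m) = u , ⊑-trans le le′ , m

Sim⇒Match : ∀ {s t : Tree nv np} → pars s ≡ pars t → Sim s t → Match s t
Sim⇒Match e (t′ , le , match _ ms) = match e (All.map (Sim-⊑ le) ms)

Match-reflect : ∀ {s t : Tree nv np} → NNILpar B → Match s t → t ⊨ B → s ⊨ B
Match-reflect {nv} {np} (nnil , onlyPar) = Simulation.reflect (𝕋 nv np) (𝕋 nv np) Match Match-forth
  (λ {s} {t} m → pars-≡ {s = s} {t = t} (Match-pars m)) nnil onlyPar

Match-refl : (t : Tree nv np) → Match t t
Match-refl = tree-ind _ λ t ih → match refl (All.tabulate λ {c} i → c , step i done , ih i)

Match-trans : ∀ {s t u : Tree nv np} → Match s t → Match t u → Match s u
Match-trans {u = u} (match e ms) m = match (≡-trans e (Match-pars m)) (go ms)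
  where
  go : ∀ {cs} → All (λ c → Sim c _) cs → All (λ c → Sim c u) cs
  go []                      = []
  go ((t′ , le , m′) ∷ ms) =
    let u′ , le′ , m″ = Match-forth m le in (u′ , le′ , Match-trans m′ m″) ∷ go ms

Sim-trans : ∀ {s t u : Tree nv np} → Sim s t → Sim t u → Sim s u
Sim-trans (t′ , le , m) (u′ , le′ , m′) =
  let u″ , le″ , m″ = Match-forth m′ le in u″ , ⊑-trans le′ le″ , Match-trans m m″

-- A NNIL(par) formula that fails exactly at the trees into which s maps.
notSim  : Tree nv np → Fm nv np
notSims : List (Tree nv np) → Fm nv np
outside : Subset np → List (Fm nv np)
outside {np} ps = map (λ i → at (par i)) (filter (λ i → ¬? (i ∈? ps)) (allFin np))
notSim (node l cs) = conjPar (pars (node l cs)) ⇒ ⋁ (outside (pars (node l cs))) ∨ notSims cs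
notSims []       = ⊥'
notSims (c ∷ cs) = notSim c ∨ notSims cs

⊨-outside : ∀ {t : Tree nv np} ps → (t ⊨ ⋁ (outside ps)) ⇔ (Σ (Fin np) λ i → ¬ i ∈S ps × T (treeVal t (par i)))
⊨-outside {np = np} {t = t} ps = mk⇔ f g
  where
  f : t ⊨ ⋁ (outside ps) → Σ (Fin np) λ i → ¬ i ∈S ps × T (treeVal t (par i))
  f x with to (⊨-⋁ (𝕋 _ _) (outside ps)) x
  ... | B , j , y with ∈-map⁻ (λ i → at (par i)) j
  ... | i , k , refl = i , proj₂ (∈-filter⁻ (λ i → ¬? (i ∈? ps)) {xs = allFin np} k) , y
  g : (Σ (Fin np) λ i → ¬ i ∈S ps × T (treeVal t (par i))) → t ⊨ ⋁ (outside ps)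
  g (i , n , y) = from (⊨-⋁ (𝕋 _ _) (outside ps)) (at (par i) ,
    ∈-map⁺ (λ i → at (par i)) (∈-filter⁺ (λ i → ¬? (i ∈? ps)) (∈-allFin i) n) , y)

⊨-pars : ∀ {t : Tree nv np} ps → (t ⊨ conjPar ps) ⇔ (ps ⊆ pars t)
⊨-pars ps = mk⇔
  (λ x {i} j → from (∈-tabulate _ i) (to (⊨-conjPar (𝕋 _ _) ps) x i j))
  (λ h → from (⊨-conjPar (𝕋 _ _) ps) λ i j → to (∈-tabulate _ i) (h j))

notSim-sound  : ∀ {s t : Tree nv np} → Sim s t → ¬ (t ⊨ notSim s)
notSims-sound : ∀ {cs} {t : Tree nv np} → All (λ c → Sim c t) cs → ¬ (t ⊨ notSims cs)
notSim-sound {s = node l cs} (t , le , match e ms) x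
  with x t le (from (⊨-pars _) (λ i → subst (_ ∈S_) e i))
... | inj₁ y = let i , n , z = to (⊨-outside _) y in
               n (subst (i ∈S_) (sym e) (from (∈-tabulate _ i) z))
... | inj₂ y = notSims-sound ms y
notSims-sound (m ∷ ms) (inj₁ x) = notSim-sound m x
notSims-sound (m ∷ ms) (inj₂ x) = notSims-sound ms x

-- A node refuting the implication forces the parameters of `s` and none outside, so it can be the
-- image of the root; the failing disjunction over the children provides their images above it.
notSim-complete  : ∀ (s : Tree nv np) {t} → ¬ (t ⊨ notSim s) → Sim s t
notSims-complete : ∀ (cs : List (Tree nv np)) {t} → ¬ (t ⊨ notSims cs) → All (λ c → Sim c t) cs
notSim-complete {nv} {np} s@(node l cs) {t} n
  with search (𝕋 nv np) (λ u → ⊨? (𝕋 nv np) (conjPar (pars s)) u →-dec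
                                ⊨? (𝕋 nv np) (⋁ (outside (pars s)) ∨ notSims cs) u) t
... | inj₁ f            = ⊥-elim (n f)
... | inj₂ (u , le , m) with ⊨? (𝕋 nv np) (conjPar (pars s)) u
... | no k  = ⊥-elim (m λ x → ⊥-elim (k x))
... | yes x = u , le , match
  (⊆-antisym (to (⊨-pars _) x) λ {i} j → decidable-stable (i ∈? _) λ k →
     m λ _ → inj₁ (from (⊨-outside _) (i , k , to (∈-tabulate _ i) j)))
  (notSims-complete cs λ y → m λ _ → inj₂ y)
notSims-complete []       n = []
notSims-complete (c ∷ cs) n = notSim-complete c (n ∘ inj₁) ∷ notSims-complete cs (n ∘ inj₂)

NNILpar-⋀ : ∀ (As : List (Fm nv np)) → (∀ {B} → B ∈L As → NNILpar B) → NNILpar (⋀ As)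
NNILpar-⋀ []       h = top , imp bot bot
NNILpar-⋀ (A ∷ As) h with h (here refl) | NNILpar-⋀ As (λ i → h (there i))
... | x , p | y , q = and x y , and p q

NNILpar-⋁ : ∀ (As : List (Fm nv np)) → (∀ {B} → B ∈L As → NNILpar B) → NNILpar (⋁ As)
NNILpar-⋁ []       h = bot , bot
NNILpar-⋁ (A ∷ As) h with h (here refl) | NNILpar-⋁ As (λ i → h (there i))
... | x , p | y , q = or x y , or p q

NI-conjPar : ∀ ps → NI {nv} {np} (conjPar ps) × OnlyPar {nv} (conjPar ps)
NI-conjPar {nv} {np} ps = go (filter (_∈? ps) (allFin np))
  where
  go : ∀ is → let X = ⋀ {nv} {np} (map (λ i → at (par i)) is) in NI X × OnlyPar X
  go []       = top , imp bot bot
  go (i ∷ is) = let x , p = go is in and (at (par i)) x , and (par i) p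

NNILpar-conjPar⇒ : ∀ ps {B : Fm nv np} → NNILpar B → NNILpar (conjPar ps ⇒ B)
NNILpar-conjPar⇒ ps (x , p) = let y , q = NI-conjPar ps in imp y x , imp q p

NNILpar-outside : ∀ ps → NNILpar {nv} {np} (⋁ (outside ps))
NNILpar-outside ps = NNILpar-⋁ (outside ps) λ i → case ∈-map⁻ (λ i → at (par i)) i of λ
  { (j , _ , refl) → at (par j) , par j }

notSim-NNIL  : (s : Tree nv np) → NNILpar (notSim s)
notSims-NNIL : (cs : List (Tree nv np)) → NNILpar (notSims cs)
notSim-NNIL (node l cs) =
  let x , p = NNILpar-outside (pars (node l cs)) ; y , q = notSims-NNIL cs
  in NNILpar-conjPar⇒ (pars (node l cs)) (or x y , or p q)
notSims-NNIL []       = bot , bot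
notSims-NNIL (c ∷ cs) =
  let x , p = notSim-NNIL c ; y , q = notSims-NNIL cs in or x y , or p q

-- Finitely many trees up to mutual simulation, and the NNIL(par) theory of a tree.

sublists : ∀ {X : Set} → List X → List (List X)
sublists []       = [] ∷ []
sublists (x ∷ xs) = map (x ∷_) (sublists xs) ++ sublists xs

filter∈sublists : ∀ {X : Set} {P : X → Set} (P? : ∀ x → Dec (P x)) xs → filter P? xs ∈L sublists xs
filter∈sublists P? []       = here refl
filter∈sublists P? (x ∷ xs) with does (P? x)
... | true  = ∈-++⁺ˡ (∈-map⁺ (x ∷_) (filter∈sublists P? xs))
... | false = ∈-++⁺ʳ (map (x ∷_) (sublists xs)) (filter∈sublists P? xs)

∈-allSubsets : ∀ {n} (ps : Subset n) → ps ∈L allSubsets n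
∈-allSubsets Vec.[]            = here refl
∈-allSubsets (true Vec.∷ ps)  = ∈-++⁺ˡ (∈-map⁺ (true Vec.∷_) (∈-allSubsets ps))
∈-allSubsets (false Vec.∷ ps) = ∈-++⁺ʳ (map (true Vec.∷_) (allSubsets _)) (∈-map⁺ (false Vec.∷_) (∈-allSubsets ps))

sim? : (s t : Tree nv np) → Dec (Sim s t)
sim? s t with ⊨? (𝕋 _ _) (notSim s) t
... | yes x = no λ m → notSim-sound m x
... | no n  = yes (notSim-complete s n)

parLabel : Subset np → Atom nv np → Bool
parLabel ps (var _) = false
parLabel ps (par i) = Vec.lookup ps i

reps : (nv np : ℕ) → ℕ → List (Tree nv np)
reps nv np ℕ.zero    = []
reps nv np (ℕ.suc k) = cartesianProductWith (λ ps → node (parLabel ps)) (allSubsets np) (sublists (reps nv np k))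

_≈_ : Tree nv np → Tree nv np → Set
s ≈ t = Match s t × Match t s

pars-node : ∀ ps (cs : List (Tree nv np)) → (∀ {c} → c ∈L cs → ps ⊆ pars c) → pars (node (parLabel ps) cs) ≡ ps
pars-node ps cs h = ⊆-antisym
  (λ {i} x → lookup⇒[]= i ps (to T-≡ (subst T (eq i) (to (∈-tabulate _ i) x))))
  (λ {i} x → from (∈-tabulate _ i) (subst T (sym (eq i)) (from T-≡ ([]=⇒lookup x))))
  where
  eq : ∀ i → treeVal (node (parLabel ps) cs) (par i) ≡ Vec.lookup ps i
  eq i = treeVal-node {l = parLabel ps} (par i) λ j x →
    to (∈-tabulate _ i) (h j (lookup⇒[]= i ps (to T-≡ x)))

-- Every tree is equivalent to one whose parameter sets strictly increase along
-- branches, hence of height at most np.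
representative : ∀ k (t : Tree nv np) → np ℕ.≤ ∣ pars t ∣ ℕ.+ k →
                 Σ (Tree nv np) λ r → r ∈L reps nv np (ℕ.suc k) × t ≈ r
representative {nv} {np} k t bound = r , r∈ , t→r , r→t
  where
  -- The largest possible choice of children: `r` maps into `t` by construction, and every
  -- lower-level representative of a node of `t` is among them.
  cs = filter (λ r′ → sim? r′ t) (reps nv np k)
  r  = node (parLabel (pars t)) cs
  cs→t : ∀ {c} → c ∈L cs → Sim c t
  cs→t i = proj₂ (∈-filter⁻ (λ r′ → sim? r′ t) {xs = reps nv np k} i)
  r∈ : r ∈L reps nv np (ℕ.suc k)
  r∈ = ∈-cartesianProductWith⁺ (λ ps → node (parLabel ps)) (∈-allSubsets (pars t))
         (filter∈sublists (λ r′ → sim? r′ t) (reps nv np k))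
  pars-r : pars r ≡ pars t
  pars-r = pars-node (pars t) cs λ {c} i → let t′ , le , m = cs→t i in
    subst (pars t ⊆_) (sym (Match-pars m)) (pars-⊆ le)
  r→t : Match r t
  r→t = match pars-r (All.tabulate cs→t)
  above : ∀ k′ → k ≡ k′ → ∀ {s} → t ⊑ s → ∣ pars t ∣ ℕ.< ∣ pars s ∣ → Sim s r
  above ℕ.zero refl {s} le lt =
    ⊥-elim (ℕₚ.<-irrefl refl (ℕₚ.<-≤-trans lt (ℕₚ.≤-trans (∣p∣≤n (pars s)) (subst (np ℕ.≤_) (ℕₚ.+-identityʳ _) bound))))
  above (ℕ.suc k′) refl {s} le lt with representative k′ s
    (ℕₚ.≤-trans bound (subst (ℕ._≤ ∣ pars s ∣ ℕ.+ k′) (sym (ℕₚ.+-suc _ k′)) (ℕₚ.+-monoˡ-≤ k′ lt)))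
  ... | r′ , i , m , m′ = r′ , step (∈-filter⁺ (λ r′ → sim? r′ t) i (s , le , m′)) done , m
  nodes : ∀ s → t ⊑ s → Sim s r
  -- Nodes with the same parameters as `t` collapse to the root of `r`; a node with more parameters
  -- goes to the child representing it, at the cost of one level.
  nodes = tree-ind _ λ s ih le → case Fₚ.any? (λ i → (i ∈? pars s) ×-dec ¬? (i ∈? pars t)) of λ where
    (yes w) → above k refl le (p⊂q⇒∣p∣<∣q∣ (pars-⊆ le , w))
    (no n)  → r , done , match
      (≡-trans (⊆-antisym (λ {i} x → decidable-stable (i ∈? pars t) (λ y → n (i , x , y))) (pars-⊆ le)) (sym pars-r))
      (All.tabulate λ i → ih i (⊑-trans le (step i done)))
  t→r : Match t r
  t→r = Sim⇒Match (sym pars-r) (nodes t done)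

abstract
  -- A strictly increasing chain of subsets of `np` parameters has at most `suc np` members, hence
  -- the number of levels.
  allReps : (nv np : ℕ) → List (Tree nv np)
  allReps nv np = reps nv np (ℕ.suc np)

  rep : (t : Tree nv np) → Σ (Tree nv np) λ r → r ∈L allReps nv np × t ≈ r
  rep {np = np} t = representative np t (ℕₚ.m≤n+m np ∣ pars t ∣)

forced : Tree nv np → List (Fm nv np)
forced {nv} {np} t = filter (λ B → ⊨? (𝕋 nv np) B t) (map notSim (allReps nv np))

forced⁺ : ∀ {r t : Tree nv np} → r ∈L allReps nv np → t ⊨ notSim r → notSim r ∈L forced t
forced⁺ {nv} {np} {t = t} i = ∈-filter⁺ (λ B → ⊨? (𝕋 nv np) B t) (∈-map⁺ notSim i)

forced⁻ : ∀ {t : Tree nv np} {B} → B ∈L forced t → NNILpar B × t ⊨ B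
forced⁻ {nv} {np} {t} i with ∈-filter⁻ (λ B → ⊨? (𝕋 nv np) B t) {xs = map notSim (allReps nv np)} i
... | j , x with ∈-map⁻ notSim j
... | r , _ , refl = notSim-NNIL r , x

abstract
  -- The formulas `notSim r` suffice as axioms: a tree forcing all those true in `t` maps into `t`,
  -- and NNIL(par) formulas are reflected along that map.
  theory : Tree nv np → Fm nv np
  theory t = ⋀ (forced t)

  theory-NNIL : (t : Tree nv np) → NNILpar (theory t)
  theory-NNIL t = NNILpar-⋀ (forced t) λ i → proj₁ (forced⁻ {t = t} i)

  ⊨-theory : (t : Tree nv np) → t ⊨ theory t
  ⊨-theory {nv} {np} t = from (⊨-⋀ (𝕋 nv np) (forced t)) λ i → proj₂ (forced⁻ {t = t} i)

  -- If `r` represents `s`, then `notSim r` fails at `s`, so it is not a conjunct of `theory t`. It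
  -- therefore fails at `t`, which means that `r`, and with it `s`, maps into `t`.
  theory⇒Sim : ∀ {s t : Tree nv np} → s ⊨ theory t → Sim s t
  theory⇒Sim {nv} {np} {s} {t} x with rep s
  ... | r , i , s→r , r→s = Sim-trans (r , done , s→r) (notSim-complete r λ y →
    notSim-sound (s , done , r→s) (to (⊨-⋀ (𝕋 nv np) (forced t)) x (forced⁺ {t = t} i y)))

Sim-reflect : ∀ {s t : Tree nv np} {B} → NNILpar B → Sim s t → t ⊨ B → s ⊨ B
Sim-reflect {B = B} nb (t′ , le , m) y = Match-reflect nb m (⊨-mono (𝕋 _ _) B le y)

theory-least : ∀ {t : Tree nv np} {B} → NNILpar B → t ⊨ B → (theory t ∷ []) ⊢ B
theory-least nb x = completeness λ s ρ → Sim-reflect nb (theory⇒Sim (ρ (here refl))) x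

theoryConj : ∀ {K : Model nv np} {t r} → (∀ A → (K ⊩ A) ⇔ (t ⊨ A)) → t ≈ r → IsTheoryConj K (theory r)
theoryConj {r = r} K⇔t (t→r , r→t) =
  theory-NNIL r ,
  from (K⇔t (theory r)) (Sim-reflect (theory-NNIL r) (_ , done , t→r) (⊨-theory r)) ,
  λ B nb x → theory-least nb (Sim-reflect nb (_ , done , r→t) (to (K⇔t B) x))

⊩-tree : (K : Model nv np) → Σ (Tree nv np) λ t → ∀ A → (K ⊩ A) ⇔ (t ⊨ A)
⊩-tree K = let t , e = tree-of K (root K) in t , λ A → e A ⇔-∘ forces⇔⊨ K A

⊩ₚ⇔ : (K : Model nv np) → ∀ ps → (K ⊩ₚ ps) ⇔ (K ⊩ conjPar ps)
⊩ₚ⇔ K ps = ⇔-sym (⊨-conjPar ⟦ K ⟧ ps ⇔-∘ forces⇔⊨ K (conjPar ps))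

-- The finite lists of disjuncts of A†.

module Dagger {nv np : ℕ} (A : Fm nv np) where

  hyps : Subset np → Tree nv np → List (Fm nv np)
  hyps ps r = conjPar ps ∷ A ∷ theory r ∷ []

  -- theory r bounds the NNIL(par) theory of a countermodel to notSim r from
  -- below and the failure of notSim r bounds it from above, so the countermodel
  -- has exactly the theory of r.
  Realised : Subset np → Tree nv np → Set
  Realised ps r = ¬ (hyps ps r ⊢ notSim r)

  realised? : ∀ ps r → Dec (Realised ps r)
  realised? ps r = ¬? (hyps ps r ⊢? notSim r)

  disjuncts : Subset np → List (Fm nv np)
  disjuncts ps = map theory (filter (realised? ps) (allReps nv np))

  realise : ∀ {ps r} → Realised ps r → Σ (Tree nv np) λ t → t ⊨ conjPar ps × t ⊨ A × t ≈ r
  realise {ps} {r} n with derivable⊎countermodel (hyps ps r) (notSim r)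
  ... | inj₁ d           = ⊥-elim (n d)
  ... | inj₂ (t , ρ , m) with notSim-complete r m
  -- The root of `r` may be sent strictly above the root of `t`. Its image `t′` is taken as the
  -- model instead; the hypotheses persist to it, and equal parameters turn the map from `t′` back
  -- into `r` into one preserving roots.
  ... | t′ , le , r→t′ =
    t′ , ⊨-mono (𝕋 _ _) (conjPar ps) le (ρ (here refl)) , ⊨-mono (𝕋 _ _) A le (ρ (there (here refl))) ,
    Sim⇒Match (sym (Match-pars r→t′)) (theory⇒Sim (⊨-mono (𝕋 _ _) (theory r) le (ρ (there (there (here refl)))))) , r→t′

  realised : ∀ {ps r t} → t ⊨ conjPar ps → t ⊨ A → t ≈ r → Realised ps r
  realised {r = r} {t} x y (t→r , r→t) d = notSim-sound (t , done , r→t)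
    (soundness (𝕋 _ _) d t λ { (here refl) → x ; (there (here refl)) → y
      ; (there (there (here refl))) → Sim-reflect (theory-NNIL r) (r , done , t→r) (⊨-theory r) })

  realises : ∀ {ps r} K t → (∀ B → (K ⊩ B) ⇔ (t ⊨ B)) → t ⊨ conjPar ps → t ⊨ A → t ≈ r →
             K ⊩ₚ ps × K ⊩ A × IsTheoryConj K (theory r)
  realises {ps} K t K⇔t x y e =
    from (⊩ₚ⇔ K ps) (from (K⇔t (conjPar ps)) x) , from (K⇔t A) y , theoryConj K⇔t e

  daggerLists : DaggerLists A disjuncts
  daggerLists ps = (λ C i → sound (∈-map⁻ theory i)) , complete
    where
    sound : ∀ {C} → (Σ (Tree nv np) λ r → r ∈L filter (realised? ps) (allReps nv np) × C ≡ theory r) →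
            Σ (Model nv np) λ K → K ⊩ₚ ps × K ⊩ A × IsTheoryConj K C
    sound (r , j , refl) =
      let t , x , y , e = realise {ps} {r} (proj₂ (∈-filter⁻ (realised? ps) {xs = allReps nv np} j))
      in treeModel t , realises (treeModel t) t (treeModel-⊩ t) x y e
    complete : ∀ K → K ⊩ₚ ps → K ⊩ A → Σ (Fm nv np) λ C → C ∈L disjuncts ps × IsTheoryConj K C
    complete K x y =
      let t , K⇔t   = ⊩-tree K
          r , i , e = rep t
          t⊨ps      = to (K⇔t (conjPar ps)) (to (⊩ₚ⇔ K ps) x)
          t⊨A       = to (K⇔t A) y
      in theory r , ∈-map⁺ theory (∈-filter⁺ (realised? ps) i (realised {ps} {r} t⊨ps t⊨A e)) , theoryConj K⇔t e

-- Turning a simulation into a submodel.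

data Emb  {nv np} : Tree nv np → Tree nv np → Set
data Embs {nv np} : List (Tree nv np) → List (Tree nv np) → Set

data Emb {nv np} where
  emb : ∀ {s t} → pars s ≡ pars t → Embs (children s) (children t) → Emb s t

-- Children are matched one to one with an initial segment of the target's children. This gives the
-- injectivity and order reflection that a submodel requires and a `Match` lacks.
data Embs {nv np} where
  nil  : ∀ {ds} → Embs [] ds
  keep : ∀ {c d cs ds} → Emb c d → Embs cs ds → Embs (c ∷ cs) (d ∷ ds)

emap  : ∀ {s t : Tree nv np} → Emb s t → Path s → Path t
emaps : ∀ {cs ds : List (Tree nv np)} → Embs cs ds → Paths cs → Paths ds
emap {s = node _ _} {node _ _} (emb _ es) (inj₁ x) = inj₁ x
emap {s = node _ _} {node _ _} (emb _ es) (inj₂ p) = inj₂ (emaps es p)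
emaps (keep e es) (inj₁ p) = inj₁ (emap e p)
emaps (keep e es) (inj₂ p) = inj₂ (emaps es p)

emap-injective  : ∀ {s t : Tree nv np} (e : Emb s t) p q → emap e p ≡ emap e q → p ≡ q
emaps-injective : ∀ {cs ds : List (Tree nv np)} (es : Embs cs ds) p q → emaps es p ≡ emaps es q → p ≡ q
emap-injective {s = node _ _} {node _ _} (emb _ es) (inj₁ p) (inj₁ q) eq = refl
emap-injective {s = node _ _} {node _ _} (emb _ es) (inj₂ p) (inj₂ q) eq =
  cong inj₂ (emaps-injective es p q (inj₂-injective eq))
emaps-injective (keep e es) (inj₁ p) (inj₁ q) eq = cong inj₁ (emap-injective e p q (inj₁-injective eq))
emaps-injective (keep e es) (inj₂ p) (inj₂ q) eq = cong inj₂ (emaps-injective es p q (inj₂-injective eq))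

emap-below  : ∀ {s t : Tree nv np} (e : Emb s t) p q → below s p q ≡ below t (emap e p) (emap e q)
emaps-below : ∀ {cs ds : List (Tree nv np)} (es : Embs cs ds) p q → belows cs p q ≡ belows ds (emaps es p) (emaps es q)
emap-below {s = node _ _} {node _ _} (emb _ es) (inj₁ p) (inj₁ q) = refl
emap-below {s = node _ _} {node _ _} (emb _ es) (inj₁ p) (inj₂ q) = refl
emap-below {s = node _ _} {node _ _} (emb _ es) (inj₂ p) (inj₁ q) = refl
emap-below {s = node _ _} {node _ _} (emb _ es) (inj₂ p) (inj₂ q) = emaps-below es p q
emaps-below (keep e es) (inj₁ p) (inj₁ q) = emap-below e p q
emaps-below (keep e es) (inj₁ p) (inj₂ q) = refl
emaps-below (keep e es) (inj₂ p) (inj₁ q) = refl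
emaps-below (keep e es) (inj₂ p) (inj₂ q) = emaps-below es p q

emap-pars  : ∀ {s t : Tree nv np} (e : Emb s t) p → pars (subtree s p) ≡ pars (subtree t (emap e p))
emaps-pars : ∀ {cs ds : List (Tree nv np)} (es : Embs cs ds) p → pars (subtrees cs p) ≡ pars (subtrees ds (emaps es p))
emap-pars {s = node _ _} {node _ _} (emb eq es) (inj₁ p) = eq
emap-pars {s = node _ _} {node _ _} (emb eq es) (inj₂ p) = emaps-pars es p
emaps-pars (keep e es) (inj₁ p) = emap-pars e p
emaps-pars (keep e es) (inj₂ p) = emaps-pars es p

-- The valuation on the source may come from any σ: substitutions fix parameters, and only
-- parameters are compared.
Emb⇒SubmodelPar : ∀ (σ : Subst {nv} {np}) {s t} → Emb s t → SubmodelPar (substModel σ s) (treeModel t)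
Emb⇒SubmodelPar {nv} {np} σ {s} {t} e = record
  { emb    = f
  ; inj    = λ u w eq → S.path-injective (emap-injective e _ _
               (≡-trans (sym (T′.path-index _)) (≡-trans (cong T′.path eq) (T′.path-index _))))
  ; order  = λ u w → ≡-trans (emap-below e (S.path u) (S.path w))
               (sym (cong₂ (below t) (T′.path-index _) (T′.path-index _)))
  ; valPar = λ w i → ≡-trans
               (pars-≡ {s = subtree s (S.path w)} {subtree t (emap e (S.path w))} (emap-pars e (S.path w)) i)
               (cong (λ p → treeVal (subtree t p) (par i)) (sym (T′.path-index _))) }
  where
  module S = SubstModel σ s
  module T′ = SubstModel {nv} {np} idSubst t
  f : Fin (count s) → Fin (count t)
  f w = T′.index (emap e (S.path w))

_≋_ : Tree nv np → Tree nv np → Set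
s ≋ t = ∀ B → (s ⊨ B) ⇔ (t ⊨ B)

-- Extra children equivalent to nodes above `t`, possibly to `t` itself, are invisible to forcing as
-- long as the old children stay.
≋-node : ∀ {s t : Tree nv np} → (∀ a → treeVal s a ≡ treeVal t a) →
         (∀ {c} → c ∈L children s → Σ (Tree nv np) λ t′ → t ⊑ t′ × c ≋ t′) →
         (∀ {d} → d ∈L children t → d ∈L children s) → s ≋ t
≋-node v f b (at a)  = mk⇔ (subst T (v a)) (subst T (sym (v a)))
≋-node v f b ⊥'      = ⇔-id _
≋-node v f b (A ∧ B) = ≋-node v f b A ×-⇔ ≋-node v f b B
≋-node v f b (A ∨ B) = ≋-node v f b A ⊎-⇔ ≋-node v f b B
≋-node v f b (A ⇒ B) = mk⇔
  (λ h → from (⊨-⇒ {A = A} {B})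
    ( (λ x → to (≋-node v f b B) (proj₁ (to (⊨-⇒ {A = A} {B}) h) (from (≋-node v f b A) x)))
    , λ i → proj₂ (to (⊨-⇒ {A = A} {B}) h) (b i)))
  (λ h → from (⊨-⇒ {A = A} {B})
    ( (λ x → from (≋-node v f b B) (h _ done (to (≋-node v f b A) x)))
    , λ i → let t′ , le , e = f i in from (e (A ⇒ B)) (⊨-mono (𝕋 _ _) (A ⇒ B) le h)))

-- Grafting the children of the image under each node of s makes s a submodel
-- of a tree that forces the same formulas as t.
expand : ∀ {s t : Tree nv np} → Match s t → Σ (Tree nv np) λ n → Emb s n × n ≋ t
expands : ∀ {cs} {t : Tree nv np} → All (λ c → Σ (Tree nv np) λ t′ → t ⊑ t′ × Match c t′) cs →
          Σ (List (Tree nv np)) λ ns → Embs cs ns ×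
          (∀ {c} → c ∈L ns → Σ (Tree nv np) λ t′ → t ⊑ t′ × c ≋ t′) × (∀ {d} → d ∈L children t → d ∈L ns)
expand {nv} {np} {s = s} {t} (match e ms) with expands ms
... | ns , es , f , b = n , emb (≡-trans e (sym (pars-n))) es , ≋-node v f b
  where
  n : Tree nv np
  n = node (treeVal t) ns
  v : ∀ a → treeVal n a ≡ treeVal t a
  v a = treeVal-node {l = treeVal t} a λ i x → let t′ , le , eq = f i in from (eq (at a)) (treeVal-mono a le x)
  pars-n : pars n ≡ pars t
  pars-n = tabulate-cong λ i → v (par i)
expands {t = t} [] = children t , nil , (λ i → _ , step i done , λ B → ⇔-id _) , id
expands ((t′ , le , m) ∷ ms) with expand m | expands ms
... | n , e , eq | ns , es , f , b =
  n ∷ ns , keep e es , (λ { (here refl) → t′ , le , eq ; (there i) → f i }) , there ∘ b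

-- The substitution θ_A

thetaX-∈ : ∀ (A : Fm nv np) {xs x} → x ∈S xs → thetaX A xs x ≡ (A ⇒ at (var x))
thetaX-∈ A {xs} {x} i rewrite dec-true (x ∈? xs) i = refl

thetaX-∉ : ∀ (A : Fm nv np) {xs x} → ¬ x ∈S xs → thetaX A xs x ≡ A ∧ at (var x)
thetaX-∉ A {xs} {x} i rewrite dec-false (x ∈? xs) i = refl

module Theta {nv np : ℕ} (A : Fm nv np) where

  -- Under A both A → x and A ∧ x are equivalent to x.
  stable₁ : ∀ (σ : Subst {nv} {np}) xs B {t} → t ⊨ apply σ A →
            (t ⊨ apply σ B) ⇔ (t ⊨ apply (σ ∘s thetaX A xs) B)
  stable₁ σ xs B x = ⊨-agree (𝕋 nv np) (apply σ A) σ (σ ∘s thetaX A xs) agree B x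
    where
    agree : ∀ {t} → t ⊨ apply σ A → ∀ i → (t ⊨ σ i) ⇔ (t ⊨ apply σ (thetaX A xs i))
    agree x i with does (i ∈? xs)
    ... | true  = mk⇔ (λ y u le _ → ⊨-mono (𝕋 _ _) (σ i) le y) (λ f → f _ done x)
    ... | false = mk⇔ (x ,_) proj₂

  θ : List (Subset nv) → Fm nv np → Fm nv np
  θ L = apply (thetaList A L)

  -- The steps of `R` act on the valuation before those of `P`, so a node where A holds after `R` is
  -- left alone by `P`.
  stable : ∀ P R B {t} → t ⊨ θ R A → (t ⊨ θ R B) ⇔ (t ⊨ θ (P ++ R) B)
  stable []       R B x = ⇔-id _
  stable (xs ∷ P) R B x = stable₁ (thetaList A (P ++ R)) xs B (to (stable P R A x) x) ⇔-∘ stable P R B x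

  ⊨-θ : ∀ L B {t} → t ⊨ A → (t ⊨ B) ⇔ (t ⊨ θ L B)
  ⊨-θ L B {t} x = subst₂ (λ X P → (t ⊨ X) ⇔ (t ⊨ θ P B)) (apply-id B) (++-identityʳ L)
    (stable L [] B (subst (t ⊨_) (sym (apply-id A)) x))

  thetaList-projective : ∀ L → Projective A (thetaList A L)
  thetaList-projective L a = completeness-⇔' λ t ρ → ⊨-θ L (at a) (ρ (here refl))

  -- A step θ^y with xs ⊈ y cannot make A true at a node where all of xs ends
  -- up true: some x ∈ xs is then sent to A ∧ x.
  already : ∀ P R {xs t} → (∀ {ys} → ys ∈L P → ¬ (xs ⊆ ys)) →
            t ⊨ θ (P ++ R) A → (∀ x → x ∈S xs → t ⊨ θ (P ++ R) (at (var x))) → t ⊨ θ R A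
  already []       R h x f = x
  already (ys ∷ P) R {xs} {t} h x f with Fₚ.any? (λ i → (i ∈? xs) ×-dec ¬? (i ∈? ys))
  ... | no n = ⊥-elim (h (here refl) λ {i} j → decidable-stable (i ∈? ys) λ k → n (i , j , k))
  ... | yes (i , j , k) = already P R (λ l → h (there l)) tA
          λ v l → from (stable₁ (thetaList A (P ++ R)) ys (at (var v)) tA) (f v l)
    where
    tA : t ⊨ θ (P ++ R) A
    tA = proj₁ (subst (λ X → t ⊨ θ (P ++ R) X) (thetaX-∉ A k) (f i j))

  -- A superset of `xs` standing earlier in the listing would contradict the order, so all of `P`
  -- meets the hypothesis of `already`.
  ordered-split : ∀ L {xs} → (∀ i j → lookup L i ⊆ lookup L j → toℕ i ℕ.≤ toℕ j) → xs ∈L L →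
                  Σ (List (Subset nv)) λ P → Σ (List (Subset nv)) λ R →
                  L ≡ P ++ xs ∷ R × (∀ {ys} → ys ∈L P → ¬ (xs ⊆ ys))
  ordered-split (xs ∷ L) ord (here refl) = [] , L , refl , λ ()
  ordered-split (ys ∷ L) ord (there i)
    with ordered-split L (λ i j le → ℕ.s≤s⁻¹ (ord (F.suc i) (F.suc j) le)) i
  ... | P , R , refl , h = ys ∷ P , R , refl , λ where
    (here refl) le → case ord (F.suc (Any.index i)) F.zero (subst (_⊆ ys) (lookup-index i) le) of λ ()
    (there j)      → h j

  -- Ghilardi's argument: at the step θ^xs all proper successors already force
  -- A, so the root, unless it forces A before, acquires exactly xs.
  ghilardi : ∀ L {t xs} → (∀ i j → lookup L i ⊆ lookup L j → toℕ i ℕ.≤ toℕ j) → xs ∈L L →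
    (∀ {c} → c ∈L children t → c ⊨ θ L A) →
    (∀ {c} → c ∈L children t → ∀ x → x ∈S xs → c ⊨ θ L (at (var x))) →
    (∀ σ → (∀ {c} → c ∈L children t → ∀ B {s} → c ⊑ s → (s ⊨ apply σ B) ⇔ (s ⊨ θ L B)) →
           (∀ x → (t ⊨ σ x) ⇔ x ∈S xs) → t ⊨ apply σ A) →
    t ⊨ θ L A
  ghilardi L {t} {xs} ord i cA cxs ext with ordered-split L ord i
  ... | P , R , refl , h = to (stable P (xs ∷ R) A root-A) root-A
    where
    cA′ : ∀ {c} → c ∈L children t → c ⊨ θ (xs ∷ R) A
    cA′ i = already P (xs ∷ R) h (cA i) (cxs i)
    root-A : t ⊨ θ (xs ∷ R) A
    root-A with ⊨? (𝕋 nv np) (θ R A) t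
    ... | yes x = to (stable (xs ∷ []) R A x) x
    -- A fails at the root before the step: A ∧ x is then false there, while A → x reduces to the
    -- children, where the members of `xs` hold.
    ... | no n  = ext (thetaList A (xs ∷ R))
      (λ i B le → stable P (xs ∷ R) B (⊨-mono (𝕋 _ _) (θ (xs ∷ R) A) le (cA′ i))) λ v → mk⇔ (toxs v) (fromxs v)
      where
      toxs : ∀ v → t ⊨ thetaList A (xs ∷ R) v → v ∈S xs
      toxs v x = decidable-stable (v ∈? xs) λ k →
        n (proj₁ (subst (λ X → t ⊨ θ R X) (thetaX-∉ A k) x))
      fromxs : ∀ v → v ∈S xs → t ⊨ thetaList A (xs ∷ R) v
      fromxs v k = subst (λ X → t ⊨ θ R X) (sym (thetaX-∈ A k)) (from (⊨-⇒ {A = θ R A} {B = θ R (at (var v))})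
        ( (λ x → ⊥-elim (n x))
        , λ i → subst (λ X → _ ⊨ θ R X) (thetaX-∈ A k)
                 (from (stable P (xs ∷ R) (at (var v)) (cA′ i)) (cxs i v k))))

-- A† as an NNIL(par) formula, and the implications (1) ⇒ (2) ⇒ (3).

daggerConjuncts : (Subset np → List (Fm nv np)) → List (Fm nv np)
daggerConjuncts {np = np} Ls = map (λ ps → conjPar ps ⇒ ⋁ (Ls ps)) (allSubsets np)

∈-daggerConjuncts : ∀ {B} {Ls : Subset np → List (Fm nv np)} → B ∈L daggerConjuncts Ls →
                    Σ (Subset np) λ ps → B ≡ (conjPar ps ⇒ ⋁ (Ls ps))
∈-daggerConjuncts {Ls = Ls} i = let ps , _ , e = ∈-map⁻ (λ ps → conjPar ps ⇒ ⋁ (Ls ps)) i in ps , e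

NNILpar-daggerOf : (A : Fm nv np) → ∀ {Ls} → DaggerLists A Ls → NNILpar (daggerOf Ls)
NNILpar-daggerOf A {Ls} dl = NNILpar-⋀ (daggerConjuncts Ls) λ i → conjunct (∈-daggerConjuncts {Ls = Ls} i)
  where
  conjunct : ∀ {B} → (Σ _ λ ps → B ≡ (conjPar ps ⇒ ⋁ (Ls ps))) → NNILpar B
  conjunct (ps , refl) = NNILpar-conjPar⇒ ps (NNILpar-⋁ (Ls ps) λ {C} i →
    let _ , _ , _ , nnil , _ = proj₁ (dl ps) C i in nnil)

cond1⇒cond2 : ∀ L (A : Fm nv np) → Cond1 L A → Cond2 A
cond1⇒cond2 L A (proj , Ls , dl , eq) = thetaList A L , proj , daggerOf Ls , NNILpar-daggerOf A dl , eq

cond2⇒cond3 : (A : Fm nv np) → Cond2 A → Cond3 A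
cond2⇒cond3 {nv} {np} A (σ , proj , B , (nnil , onlyPar) , eq) K K' K⊩A sub K'⊩⁻A =
  value , value-mono ,
  -- Away from the root A is forced, so projectivity makes the truth of σ(a) agree with that of a.
  ((λ w a n → T-⇔⇒≡
     (⇔-sym (⊨-projective proj ⟦ K' ⟧ (at a) (to (forces⇔⊨ K' A) (K'⊩⁻A w n))) ⇔-∘ T-does (value? w a)))
   , λ i → refl) ,
  from (forces⇔⊨ K'' A) (subst (λ X → [ ⟦ K'' ⟧ ] root K' ⊨ X) (apply-id A)
    (from K''⇔K' (from (⊨-⇔' ⟦ K' ⟧ {A = apply σ A} {B} (soundness ⟦ K' ⟧ eq _ λ ())) K'⊨B)))
  where
  open SubmodelPar sub renaming (emb to ι)
  value? : ∀ w a → Dec ([ ⟦ K' ⟧ ] w ⊨ applyAt σ a)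
  value? w a = ⊨? ⟦ K' ⟧ (applyAt σ a) w
  value : Fin (size K') → Atom nv np → Bool
  value w a = does (value? w a)
  value-mono : ∀ u w a → T (_≺_ K' u w) → T (value u a) → T (value w a)
  value-mono u w a lt x = from (T-does (value? w a))
    (⊨-mono ⟦ K' ⟧ (applyAt σ a) (inj₂ lt) (to (T-does (value? u a)) x))
  K'' : Model nv np
  K'' = withVal K' value value-mono
  K''⇔K' : ([ ⟦ K'' ⟧ ] root K' ⊨ apply idSubst A) ⇔ ([ ⟦ K' ⟧ ] root K' ⊨ apply σ A)
  K''⇔K' = Bisimulation.⊨⇔ ⟦ K'' ⟧ ⟦ K' ⟧ idSubst σ _≡_
    (λ { refl le → _ , le , refl }) (λ { refl le → _ , le , refl })
    (λ { refl (var x) → T-does (value? _ (var x)) ; refl (par i) → T-does (value? _ (par i)) })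
    A refl
  K⊨B : [ ⟦ K ⟧ ] root K ⊨ B
  K⊨B = to (⊨-⇔' ⟦ K ⟧ {A = apply σ A} {B} (soundness ⟦ K ⟧ eq _ λ ()))
    (to (⊨-projective proj ⟦ K ⟧ A x) x)
    where x = to (forces⇔⊨ K A) K⊩A
  K'⊨B : [ ⟦ K' ⟧ ] root K' ⊨ B
  K'⊨B = Simulation.reflect ⟦ K' ⟧ ⟦ K ⟧ (λ u v → ι u ≡ v)
    (λ { refl (inj₁ refl) → _ , inj₁ refl , refl
       ; refl (inj₂ lt) → _ , inj₂ (subst T (order _ _) lt) , refl })
    (λ { refl i → valPar _ i })
    nnil onlyPar refl
    -- The root of the submodel may lie anywhere in `K`, so `B` is first carried up to its image.
    (⊨-mono ⟦ K ⟧ B ([ inj₁ ∘ sym , inj₂ ]′ (rootLeast K (ι (root K')))) K⊨B)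

⊨-daggerOf : ∀ {Ls} {t : Tree nv np} →
             (t ⊨ daggerOf Ls) ⇔ (∀ ps → t ⊨ conjPar ps ⇒ ⋁ (Ls ps))
⊨-daggerOf {Ls = Ls} = mk⇔
  (λ x ps → to (⊨-⋀ (𝕋 _ _) (daggerConjuncts Ls)) x (∈-map⁺ (λ ps → conjPar ps ⇒ ⋁ (Ls ps)) (∈-allSubsets ps)))
  (λ f → from (⊨-⋀ (𝕋 _ _) (daggerConjuncts Ls)) λ i → conjunct f (∈-daggerConjuncts {Ls = Ls} i))
  where
  conjunct : ∀ {t B} → (∀ ps → t ⊨ conjPar ps ⇒ ⋁ (Ls ps)) →
             (Σ _ λ ps → B ≡ (conjPar ps ⇒ ⋁ (Ls ps))) → t ⊨ B
  conjunct f (ps , refl) = f ps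

-- At each node above `t`, the tree with its σ-valuation is itself one of the models over which A†
-- ranges; σ fixes the formulas over parameters, so the disjunct true in that model is true at the
-- node.
apply⇒dagger : ∀ {A : Fm nv np} {Ls} σ → DaggerLists A Ls → ∀ {t} → t ⊨ apply σ A → t ⊨ daggerOf Ls
apply⇒dagger {A = A} {Ls} σ dl x = from (⊨-daggerOf {Ls = Ls}) λ ps u le y →
  let K = substModel σ u
      K⊩ps = from (⊩ₚ⇔ K ps) (from (substModel-⊩ σ u (conjPar ps))
               (subst (u ⊨_) (sym (apply-OnlyPar σ (proj₂ (NI-conjPar ps)))) y))
      C , i , (_ , onlyPar) , K⊩C , _ =
        proj₂ (dl ps) K K⊩ps (from (substModel-⊩ σ u A) (⊨-mono (𝕋 _ _) (apply σ A) le x))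
  in from (⊨-⋁ (𝕋 _ _) (Ls ps)) (C , i , subst (u ⊨_) (apply-OnlyPar σ onlyPar) (to (substModel-⊩ σ u C) K⊩C))

-- From extendibility to the equivalence of θ_A(A) with A†.

module Extendible {nv np : ℕ} (A : Fm nv np) (L : List (Subset nv)) (valid : ValidListing nv L)
                  (ext : ParExtendible A) where
  open Theta A

  σ : Subst {nv} {np}
  σ = thetaList A L

  module RootVariant {t : Tree nv np}
    (ih : ∀ {c} → c ∈L children t → c ⊨ θ L A)
    (v″ : Fin (count t) → Atom nv np → Bool)
    (pers : ∀ u w a → T (PathModel._<_ t u w) → T (v″ u a) → T (v″ w a))
    (variant : ParVariantVal (substModel σ t) v″)
    (forcesA : withVal (substModel σ t) v″ pers ⊩ A)
    where
    open SubstModel σ t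

    r : Fin (count t)
    r = index (apex t)

    xs : Subset nv
    xs = tabulate λ x → v″ r (var x)

    subtree-r : subtree t (path r) ≡ t
    subtree-r = ≡-trans (cong (subtree t) (path-index (apex t))) (subtree-apex t)

    -- Persistence of the variant carries `xs` from the root to the children, where the variant
    -- coincides with the θ_A-valuation.
    child-xs : ∀ {c} → c ∈L children t → ∀ x → x ∈S xs → c ⊨ θ L (at (var x))
    child-xs {c} i x j with child-path i
    ... | p , lt , e = subst (_⊨ σ x) (≡-trans (cong (subtree t) (path-index p)) e)
      (to (T-does (value? w (var x)))
        (subst T (proj₁ variant w (var x) w≢r)
          (pers r w (var x) r<w (to (∈-tabulate _ x) j))))
      where
      w = index p
      r<w : T (r < w)
      r<w = subst₂ (λ p q → T (below t p q)) (sym (path-index (apex t))) (sym (path-index p)) lt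
      w≢r : w ≢ r
      w≢r e = irrefl (substModel σ t) r (subst (λ u → T (r < u)) e r<w)

    -- `τ` is the composition up to and including θ^xs, as handed over by `ghilardi`. It agrees with
    -- θ_A above the root and gives `xs` at the root, so its valuation is exactly the variant.
    module _ (τ : Subst {nv} {np})
      (above : ∀ {c} → c ∈L children t → ∀ B {s} → c ⊑ s → (s ⊨ apply τ B) ⇔ (s ⊨ θ L B))
      (at-root : ∀ x → (t ⊨ τ x) ⇔ x ∈S xs)
      where

      atoms-root : ∀ a → T (v″ r a) ⇔ (t ⊨ applyAt τ a)
      atoms-root (var x) = ⇔-sym (∈-tabulate (λ x → v″ r (var x)) x ⇔-∘ at-root x)
      atoms-root (par i) = subst (λ s → T (v″ r (par i)) ⇔ (s ⊨ at (par i))) subtree-r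
        (subst (λ b → T (v″ r (par i)) ⇔ T b) (proj₂ variant i) (⇔-id _))

      atoms : ∀ w a → T (v″ w a) ⇔ (subtree t (path w) ⊨ applyAt τ a)
      atoms w a with w F.≟ r
      ... | yes w≡r = subst (λ u → T (v″ u a) ⇔ (subtree t (path u) ⊨ applyAt τ a)) (sym w≡r)
        (subst (λ s → T (v″ r a) ⇔ (s ⊨ applyAt τ a)) (sym subtree-r) (atoms-root a))
      ... | no n with nonroot t n
      ... | c , i , le = subst (λ b → T b ⇔ (subtree t (path w) ⊨ applyAt τ a)) (sym (proj₁ variant w a n))
              (⇔-sym (above i (at a) le) ⇔-∘ T-does (value? w a))

      root-forces : t ⊨ apply τ A
      root-forces = to (PathModel.⊩⇔ t v″ pers τ atoms A) forcesA

    ⊨θA : t ⊨ θ L A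
    ⊨θA = ghilardi L (proj₂ (proj₂ valid)) (proj₁ valid xs) ih child-xs root-forces

  extend : ∀ {t m} → m ⊨ A → Match t m → (∀ {c} → c ∈L children t → c ⊨ θ L A) → t ⊨ θ L A
  extend {t} {m} m⊨A t→m ih =
    let n , e , n≋m = expand t→m
        v″ , pers , variant , forcesA =
          ext (treeModel n) (substModel σ t) (from (treeModel-⊩ n A) (from (n≋m A) m⊨A)) (Emb⇒SubmodelPar σ e)
              (λ w w≢ → let c , i , le = nonroot t w≢ in
                 from (substModel-forces σ t A w) (⊨-mono (𝕋 _ _) (θ L A) le (ih i)))
    in RootVariant.⊨θA ih v″ pers variant forcesA

  dagger⇒θ : ∀ {Ls} → DaggerLists A Ls → ∀ t → t ⊨ daggerOf Ls → t ⊨ θ L A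
  dagger⇒θ {Ls} dl = tree-ind (λ t → t ⊨ daggerOf Ls → t ⊨ θ L A) step′
    where
    step′ : ∀ t → (∀ {c} → c ∈L children t → c ⊨ daggerOf Ls → c ⊨ θ L A) → t ⊨ daggerOf Ls → t ⊨ θ L A
    step′ t ih x =
      let C , i , t⊨C = to (⊨-⋁ (𝕋 _ _) (Ls (pars t)))
                           (to (⊨-daggerOf {Ls = Ls}) x (pars t) t done (from (⊨-pars (pars t)) id))
          M , _ , M⊩A , _ , _ , least = proj₁ (dl (pars t)) C i
          m , M⇔m = ⊩-tree M
          -- The identity map makes `notSim t` fail at `t`. As `C` is true at `t` and entails every
          -- NNIL(par) formula true in `M`, it fails in `M` too. The root of `t` may be sent above
          -- the root of `m`, where A persists.
          m′ , le , t→m′ = notSim-complete t {m} λ y → notSim-sound (t , done , Match-refl t)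
            (soundness₁ (𝕋 _ _) (least _ (notSim-NNIL t) (from (M⇔m (notSim t)) y)) t t⊨C)
      in extend (⊨-mono (𝕋 _ _) A le (to (M⇔m A) M⊩A)) t→m′
           λ j → ih j (⊨-mono (𝕋 _ _) (daggerOf Ls) (step j done) x)

  cond1 : Cond1 L A
  cond1 = thetaList-projective L , Dagger.disjuncts A , dl , completeness-⇔' λ t _ →
    mk⇔ (apply⇒dagger {A = A} σ dl) (dagger⇒θ dl t)
    where dl = Dagger.daggerLists A

theorem3p12 : ∀ {nv np : ℕ} (A : Fm nv np) (L : List (Subset nv)) →
    ValidListing nv L →
    ((Cond1 L A → Cond2 A) × (Cond2 A → Cond1 L A)) ×
    ((Cond2 A → Cond3 A) × (Cond3 A → Cond2 A))
theorem3p12 A L valid =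
  (cond1⇒cond2 L A , λ h → Extendible.cond1 A L valid (cond2⇒cond3 A h)) ,
  (cond2⇒cond3 A , λ h → cond1⇒cond2 L A (Extendible.cond1 A L valid h))
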